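{- Let $Q(x,y)=ax^2+bxy+cy^2$ be a primitive positive definite integral binary quadratic form and let $\Delta=b^2-4ac$. Then $\kappa_Q$ depends only on $\Delta$ and is given as follows. (i) If $4\mid\Delta$, write $\Delta=-2^nm$ with $n\ge2$ and $m$ positive and odd; when $m>1$, let $p_{\min}$ be the smallest odd prime divisor of $\Delta$. Then \[ \kappa_Q=\begin{cases}8 & \text{if }m=1\text{ and }n=3,\\ 4 & \text{if }m=1\text{ and }n\ne3,\\ \min\{8,p_{\min}\} & \text{if }m\ne1\text{ and }n=3,\\ \min\{4,p_{\min}\} & \text{if }m\neq1\text{ and }n\ne3.\end{cases} \] (ii) If $\Delta\equiv1\pmod4$, set $p_{\min}:=\min\{p\mid p\text{ is an odd prime divisor of }\Delta\}$ and $q_{\min}:=\min\{q\text{ odd prime}\mid \left(\frac{\Delta}{q}\right)=-1\}$, where $\left(\frac{\cdot}{\cdot}\right)$ is the Legendre symbol. Then \[ \kappa_Q=\begin{cases}3 & \text{if }3\mid\Delta,\\ 4 & \text{if }3\nmid\Delta\text{ and }\Delta\equiv5\pmod8,\\ \min\{p_{\min},q_{\min}^2\} & \text{if }3\nmid\Delta\text{ and }\Delta\equiv1\pmod8.\end{cases} \]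
   Context: An integral binary quadratic form $Q(x,y)=ax^2+bxy+cy^2$ has $a,b,c\in\mathbb{Z}$; it is primitive if $\gcd(a,b,c)=1$. For $l\in\mathbb{Z}$ and $k\in\mathbb{Z}_{\ge1}$, write $Q\not\equiv l\pmod k$ if $Q(x,y)\not\equiv l\pmod k$ for all $(x,y)\in\mathbb{Z}^2$. We say $Q$ has a local obstruction modulo $k$ if there exists $l\in\mathbb{Z}$ with $Q\not\equiv l\pmod k$. The minimal obstruction modulus is $\kappa_Q:=\min\{k\in\mathbb{Z}_{\ge1}\mid Q\text{ has a local obstruction modulo }k\}$, with $\kappa_Q=\infty$ if $Q$ has no local obstruction. -}

module Defs where

open import Data.Bool.Base using (if_then_else_)
open import Data.Fin.Base using (Fin; toℕ)
open import Data.Fin.Properties using (any?)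
open import Data.Integer.Base using (ℤ; +_; 0ℤ; 1ℤ; -1ℤ; _+_; _-_; _*_; _<_)
open import Data.Integer.Divisibility.Signed using (_∣_; _∣?_)
open import Data.Integer.GCD using (gcd)
open import Data.Nat.Base as ℕ using (ℕ)
import Data.Nat.Divisibility as ℕ
open import Data.Nat.Primality using (Prime)
open import Data.Product.Base using (_×_; ∃-syntax)
open import Relation.Binary.PropositionalEquality.Core using (_≡_)
open import Relation.Nullary.Construct.Add.Supremum using (_⁺; [_]; ⊤⁺)
open import Relation.Nullary.Decidable.Core using (does)
open import Relation.Nullary.Negation.Core using (¬_)

ℕ∞ : Set
ℕ∞ = ℕ ⁺

IsMin : (ℕ → Set) → ℕ → Set
IsMin P n = P n × (∀ k → P k → n ℕ.≤ k)

infix 4 _≡_[mod_]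

_≡_[mod_] : ℤ → ℤ → ℕ → Set
i ≡ j [mod k ] = + k ∣ i - j

Odd : ℕ → Set
Odd n = ¬ (2 ℕ.∣ n)

OddPrime : ℕ → Set
OddPrime p = Prime p × Odd p

-- The Legendre symbol, for p an odd prime.  Squares modulo p are the squares
-- of the representatives 0, …, p - 1.
legendre : ℤ → ℕ → ℤ
legendre i p =
  if does (+ p ∣? i) then 0ℤ
  else if does (any? λ (x : Fin p) → + p ∣? + toℕ x * + toℕ x - i) then 1ℤ
  else -1ℤ

record BinaryQuadraticForm : Set where
  constructor form
  field
    a b c : ℤ

  eval : ℤ → ℤ → ℤ
  eval x y = a * x * x + b * x * y + c * y * y

  disc : ℤ
  disc = b * b - + 4 * a * c

open BinaryQuadraticForm public using (eval; disc)

Primitive : BinaryQuadraticForm → Set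
Primitive (form a b c) = gcd (gcd a b) c ≡ 1ℤ

PositiveDefinite : BinaryQuadraticForm → Set
PositiveDefinite Q = ∀ x y → ¬ (x ≡ 0ℤ × y ≡ 0ℤ) → 0ℤ < eval Q x y

HasLocalObstruction : BinaryQuadraticForm → ℕ → Set
HasLocalObstruction Q k = ∃[ l ] (∀ x y → ¬ (eval Q x y ≡ l [mod k ]))

-- The assertion κ_Q = κ.  The modulus 0 is excluded: congruence modulo 0 is
-- equality in ℤ.
IsMinimalObstructionModulus : BinaryQuadraticForm → ℕ∞ → Set
IsMinimalObstructionModulus Q [ κ ] = IsMin (λ k → 1 ℕ.≤ k × HasLocalObstruction Q k) κ
IsMinimalObstructionModulus Q ⊤⁺    = ∀ k → 1 ℕ.≤ k → ¬ HasLocalObstruction Q k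

IsLeastOddPrimeDivisor : ℤ → ℕ → Set
IsLeastOddPrimeDivisor i = IsMin (λ p → OddPrime p × + p ∣ i)

IsLeastOddNonresiduePrime : ℤ → ℕ → Set
IsLeastOddNonresiduePrime i = IsMin (λ q → OddPrime q × legendre i q ≡ -1ℤ)

{-# OPTIONS --safe #-}
-- By the Chinese remainder theorem it is enough to know which values Q takes modulo prime powers.  For an
-- odd prime p ∤ Δ, completing the square and the pigeonhole principle show that Q takes all values modulo p;
-- if moreover Q has a nontrivial zero modulo p, i.e. (Δ/p) = 1 (or p = 2 and Δ ≡ 1 mod 8), Hensel's lemma
-- extends this to all powers of p.  Conversely, if p ∣ Δ then 4aQ is a square modulo p, so Q misses a times
-- any nonresidue; and if p is inert then p ∣ Q(x,y) forces p ∣ x, y, so Q misses p modulo p².  When Δ = 4d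
-- and a is odd, aQ = X² - dY², and X² - dY² misses a residue modulo 4 unless d ≡ 2 (mod 4), in which case
-- it takes all values modulo 4 but misses 5 modulo 8.
module Submission where

open import Defs

-- Since q² ≥ 9 for odd q, inert odd primes can matter only when the prime 2 gives no obstruction at
-- all, that is for Δ ≡ 1 (mod 8); in every other case κ is at most 8. For Δ ≡ 1 (mod 4) the formula
-- also presupposes that `pmin` and `qmin` exist. The first does because |Δ| ≡ 3 (mod 4) is odd and
-- exceeds 1. The second is where the sign of Δ enters: positive definiteness gives Δ < 0, so 4|Δ| -
-- 1 is positive and ≡ 3 (mod 4) and has a prime divisor of the same shape. Modulo that prime Δ is
-- minus an inverse of the square 4, and a descent shows that -1 is not a square there; quadratic
-- reciprocity is avoided. Each value of κ is established for all primitive forms of a fixed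
-- discriminant at once, so the dependence on Δ alone and the formula come out of a single argument.

module _ where
  open import Data.Bool.Base using (if_then_else_)
  open import Data.Empty using (⊥; ⊥-elim)
  open import Data.Fin.Base as Fin using (Fin; toℕ; fromℕ<)
  import Data.Fin.Properties as Fin
  open import Data.Integer.Base as ℤ using (ℤ; +_; -_; 0ℤ; 1ℤ; -1ℤ; _+_; _-_; _*_; _<_)
  open import Data.Integer.DivMod using (_%ℕ_; _/ℕ_; a≡a%ℕn+[a/ℕn]*n; n%ℕd<d)
  open import Data.Integer.Divisibility.Signed
  open import Data.Integer.GCD using (gcd; gcd-greatest)
  import Data.Integer.Properties as ℤ
  open import Data.Integer.Tactic.RingSolver using (solve-∀)
  open import Data.List.Base using ([]; _∷_)
  open import Data.List.Relation.Unary.All using (_∷_)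
  open import Data.Nat.Base as ℕ using (ℕ; zero; suc; NonZero)
  open import Data.Nat.Coprimality as Coprime using (Coprime; coprime-Bézout; coprime-divisor)
  open import Data.Nat.DivMod using (_%_; %-distribˡ-*; [m+kn]%n≡m%n; m%n<n)
  import Data.Nat.Divisibility as ℕ
  import Data.Nat.GCD as ℕ
  open import Data.Nat.Induction using (<-rec)
  open import Data.Nat.Primality
  open import Data.Nat.Primality.Factorisation using (factorise; PrimeFactorisation)
  import Data.Nat.Properties as ℕ
  open import Data.Nat.Tactic.RingSolver using () renaming (solve-∀ to ℕ-solve)
  open import Data.Product.Base using (_×_; _,_; ∃-syntax; proj₁; proj₂)
  open import Data.Sum.Base using (_⊎_; inj₁; inj₂; [_,_]′)
  open import Relation.Binary.PropositionalEquality
  open import Relation.Nullary.Construct.Add.Supremum using ([_]; ⊤⁺)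
  open import Relation.Nullary.Decidable
    using (Dec; yes; no; does; from-yes; from-no; _→-dec_; _⊎-dec_; _×-dec_; ¬?)
  open import Relation.Nullary.Negation.Core using (¬_; contradiction)

  -- Divisibility and congruences

  -- The pattern of most congruence proofs below, here with one term and in `∣-combine` with two: X
  -- is exhibited as an explicit combination of known multiples of m, and what remains is a
  -- polynomial identity for the ring solver.
  ∣-*ˡ : ∀ {m u} → m ∣ u → ∀ A {X} → X ≡ A * u → m ∣ X
  ∣-*ˡ m∣u A refl = ∣n⇒∣m*n A m∣u

  ∣-combine : ∀ {m u v} → m ∣ u → m ∣ v → ∀ A B {X} → X ≡ A * u + B * v → m ∣ X
  ∣-combine m∣u m∣v A B refl = ∣m∣n⇒∣m+n (∣n⇒∣m*n A m∣u) (∣n⇒∣m*n B m∣v)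

  +∣+⇒∣ : ∀ {m n} → + m ∣ + n → m ℕ.∣ n
  +∣+⇒∣ = ∣⇒∣ᵤ

  ∣⇒+∣+ : ∀ {m n} → m ℕ.∣ n → + m ∣ + n
  ∣⇒+∣+ = ∣ᵤ⇒∣

  bézout : ∀ {m n} → Coprime m n → ∃[ u ] ∃[ v ] u * + m + v * + n ≡ 1ℤ
  bézout {m} {n} c with coprime-Bézout c
  ... | ℕ.Bézout.+- x y eq = + x , - + y , (begin
    + x * + m + - + y * + n        ≡⟨ cong₂ _+_ (ℤ.pos-* x m) refl ⟨
    + (x ℕ.* m) + - + y * + n      ≡⟨ cong (λ z → + z + - + y * + n) eq ⟨
    1ℤ + + (y ℕ.* n) + - + y * + n ≡⟨ cong (λ z → 1ℤ + z + - + y * + n) (ℤ.pos-* y n) ⟩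
    1ℤ + + y * + n + - + y * + n   ≡⟨ cancel (+ y) (+ n) ⟩
    1ℤ                             ∎)
    where
    open ≡-Reasoning
    cancel : ∀ y n → 1ℤ + y * n + - y * n ≡ 1ℤ
    cancel = solve-∀
  ... | ℕ.Bézout.-+ x y eq = - + x , + y , (begin
    - + x * + m + + y * + n            ≡⟨ cong (λ z → - + x * + m + z) (ℤ.pos-* y n) ⟨
    - + x * + m + + (y ℕ.* n)          ≡⟨ cong (λ z → - + x * + m + + z) eq ⟨
    - + x * + m + (1ℤ + + (x ℕ.* m))   ≡⟨ cong (λ z → - + x * + m + (1ℤ + z)) (ℤ.pos-* x m) ⟩
    - + x * + m + (1ℤ + + x * + m)     ≡⟨ cancel (+ x) (+ m) ⟩
    1ℤ                                 ∎)
    where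
    open ≡-Reasoning
    cancel : ∀ x m → - x * m + (1ℤ + x * m) ≡ 1ℤ
    cancel = solve-∀

  prime-∤⇒coprime : ∀ {p n} → Prime p → ¬ p ℕ.∣ n → Coprime n p
  prime-∤⇒coprime pp p∤n (d∣n , d∣p) with prime⇒irreducible pp d∣p
  ... | inj₁ d≡1 = d≡1
  ... | inj₂ refl = contradiction d∣n p∤n

  prime⇒∤1 : ∀ {p} → Prime p → ¬ + p ∣ 1ℤ
  prime⇒∤1 pp p∣1 with refl ← ℕ.∣1⇒≡1 (∣⇒∣ᵤ p∣1) = ¬prime[1] pp

  euclid : ∀ {p} → Prime p → ∀ i j → + p ∣ i * j → + p ∣ i ⊎ + p ∣ j
  euclid {p} pp i j p∣ij with euclidsLemma ℤ.∣ i ∣ ℤ.∣ j ∣ pp (subst (p ℕ.∣_) (ℤ.abs-* i j) (∣⇒∣ᵤ p∣ij))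
  ... | inj₁ p∣i = inj₁ (∣ᵤ⇒∣ p∣i)
  ... | inj₂ p∣j = inj₂ (∣ᵤ⇒∣ p∣j)

  ∤-* : ∀ {p} → Prime p → ∀ {i j} → ¬ + p ∣ i → ¬ + p ∣ j → ¬ + p ∣ i * j
  ∤-* pp {i} {j} p∤i p∤j p∣ij = [ p∤i , p∤j ]′ (euclid pp i j p∣ij)

  cancel-∣ : ∀ {p} → Prime p → ∀ {i j} → ¬ + p ∣ i → + p ∣ i * j → + p ∣ j
  cancel-∣ pp {i} {j} p∤i p∣ij with euclid pp i j p∣ij
  ... | inj₁ p∣i = contradiction p∣i p∤i
  ... | inj₂ p∣j = p∣j

  ∣-square : ∀ {p} → Prime p → ∀ i → + p ∣ i * i → + p ∣ i
  ∣-square pp i p∣ii = [ (λ h → h) , (λ h → h) ]′ (euclid pp i i p∣ii)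

  inverse : ∀ {p} → Prime p → ∀ i → ¬ + p ∣ i → ∃[ v ] v * i ≡ 1ℤ [mod p ]
  inverse {p} pp i p∤i
    with u , v , eq ← bézout (prime-∤⇒coprime pp (λ p∣i → p∤i (∣ᵤ⇒∣ p∣i)))
    with m∣∣m∣ {i}
  ... | divides q ∣i∣≡qi = u * q , ∣-*ˡ ∣-refl (- v) (begin
    u * q * i - 1ℤ                            ≡⟨ cong (λ z → u * q * i - z) eq ⟨
    u * q * i - (u * + ℤ.∣ i ∣ + v * + p)       ≡⟨ cong (λ z → u * q * i - (u * z + v * + p)) ∣i∣≡qi ⟩
    u * q * i - (u * (q * i) + v * + p)       ≡⟨ rearrange u q i v (+ p) ⟩
    - v * + p                                 ∎)
    where
    open ≡-Reasoning
    rearrange : ∀ u q i v p → u * q * i - (u * (q * i) + v * p) ≡ - v * p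
    rearrange = solve-∀

  -- Multiply z by 1 = u m + v n: the term u m z is a multiple of m n because n divides z, and v n z
  -- is one because m divides z.
  coprime-*-∣ : ∀ {m n z} → Coprime m n → + m ∣ z → + n ∣ z → + (m ℕ.* n) ∣ z
  coprime-*-∣ {m} {n} c (divides q refl) n∣z
    with u , v , eq ← bézout c with n∣z
  ... | divides r eq′ = divides (u * r + v * q) (begin
    q * + m                                          ≡⟨ ℤ.*-identityʳ _ ⟨
    q * + m * 1ℤ                                     ≡⟨ cong (q * + m *_) eq ⟨
    q * + m * (u * + m + v * + n)                    ≡⟨ split q (+ m) u v (+ n) ⟩
    u * + m * (q * + m) + v * q * (+ m * + n)        ≡⟨ cong (λ z → u * + m * z + v * q * (+ m * + n)) eq′ ⟩
    u * + m * (r * + n) + v * q * (+ m * + n)        ≡⟨ collect u (+ m) r (+ n) v q ⟩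
    (u * r + v * q) * (+ m * + n)                    ≡⟨ cong ((u * r + v * q) *_) (ℤ.pos-* m n) ⟨
    (u * r + v * q) * + (m ℕ.* n)                    ∎)
    where
    open ≡-Reasoning
    split : ∀ q m u v n → q * m * (u * m + v * n) ≡ u * m * (q * m) + v * q * (m * n)
    split = solve-∀
    collect : ∀ u m r n v q → u * m * (r * n) + v * q * (m * n) ≡ (u * r + v * q) * (m * n)
    collect = solve-∀

  ≡-mod-refl : ∀ {k} i → i ≡ i [mod k ]
  ≡-mod-refl {k} i = subst (+ k ∣_) (sym (ℤ.+-inverseʳ i)) (divides 0ℤ refl)

  %-mod : ∀ i k .{{_ : NonZero k}} → + (i %ℕ k) ≡ i [mod k ]
  %-mod i k = ∣-*ˡ ∣-refl (- (i /ℕ k)) (begin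
    + (i %ℕ k) - i                                       ≡⟨ cong (λ z → + (i %ℕ k) - z) (a≡a%ℕn+[a/ℕn]*n i k) ⟩
    + (i %ℕ k) - (+ (i %ℕ k) + (i /ℕ k) * + k)           ≡⟨ cancel (+ (i %ℕ k)) (i /ℕ k) (+ k) ⟩
    - (i /ℕ k) * + k                                     ∎)
    where
    open ≡-Reasoning
    cancel : ∀ r q k → r - (r + q * k) ≡ - q * k
    cancel = solve-∀

  residue : ∀ k .{{_ : NonZero k}} i → ∃[ r ] + toℕ {k} r ≡ i [mod k ]
  residue k i = fromℕ< (n%ℕd<d i k) , subst (λ r → + r ≡ i [mod k ]) (sym (Fin.toℕ-fromℕ< _)) (%-mod i k)

  prime-divisor : ∀ n → 2 ℕ.≤ n → ∃[ p ] Prime p × p ℕ.∣ n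
  prime-divisor n@(suc _) 2≤n with factorise n
  ... | record { factors = [] ; isFactorisation = refl } = contradiction 2≤n λ { (ℕ.s≤s ()) }
  ... | record { factors = p ∷ ps ; isFactorisation = eq ; factorsPrime = pp ∷ _ } =
    p , pp , subst (p ℕ.∣_) (sym eq) (ℕ.m∣m*n _)

  coprime-* : ∀ {m m′ n} → Coprime m n → Coprime m′ n → Coprime (m ℕ.* m′) n
  coprime-* c c′ (d∣mm′ , d∣n) =
    c′ (coprime-divisor (λ (e∣d , e∣m) → c (e∣m , ℕ.∣-trans e∣d d∣n)) d∣mm′ , d∣n)

  coprime-^ : ∀ {m n} → Coprime m n → ∀ e → Coprime (m ℕ.^ e) n
  coprime-^ c zero    = Coprime.1-coprimeTo _
  coprime-^ c (suc e) = coprime-* c (coprime-^ c e)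

  m*n≥1⇒n≥1 : ∀ m n → 1 ℕ.≤ m ℕ.* n → 1 ℕ.≤ n
  m*n≥1⇒n≥1 m zero    h = subst (1 ℕ.≤_) (ℕ.*-zeroʳ m) h
  m*n≥1⇒n≥1 m (suc n) h = ℕ.s≤s ℕ.z≤n

  split-power : ∀ p → 2 ℕ.≤ p → ∀ k → 1 ℕ.≤ k → ∃[ e ] ∃[ m ] k ≡ p ℕ.^ e ℕ.* m × ¬ p ℕ.∣ m
  split-power p 2≤p = <-rec _ go
    where
    go : ∀ k → (∀ {j} → j ℕ.< k → 1 ℕ.≤ j → ∃[ e ] ∃[ m ] j ≡ p ℕ.^ e ℕ.* m × ¬ p ℕ.∣ m) →
         1 ℕ.≤ k → ∃[ e ] ∃[ m ] k ≡ p ℕ.^ e ℕ.* m × ¬ p ℕ.∣ m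
    go k rec 1≤k with p ℕ.∣? k
    ... | no p∤k = 0 , k , sym (ℕ.*-identityˡ k) , p∤k
    ... | yes (ℕ.divides-refl zero) = contradiction 1≤k λ ()
    ... | yes (ℕ.divides-refl j@(suc _)) with rec (ℕ.m<m*n j p 2≤p) (ℕ.s≤s ℕ.z≤n)
    ...   | e , m , eq , p∤m = suc e , m , (begin
      j ℕ.* p                   ≡⟨ ℕ.*-comm j p ⟩
      p ℕ.* j                   ≡⟨ cong (p ℕ.*_) eq ⟩
      p ℕ.* (p ℕ.^ e ℕ.* m)     ≡⟨ ℕ.*-assoc p _ m ⟨
      p ℕ.^ suc e ℕ.* m         ∎) , p∤m
      where open ≡-Reasoning

  prime⇒2≤ : ∀ {p} → Prime p → 2 ℕ.≤ p
  prime⇒2≤ pp = ℕ.nonTrivial⇒n>1 _ {{prime⇒nonTrivial pp}}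

  -- The prime powers to be checked are only those dividing k, so a bound k < κ passes to each of
  -- them.
  prime-power-induction : ∀ (P : ℕ → Set) → P 1 →
    (∀ {m n} → Coprime m n → P m → P n → P (m ℕ.* n)) →
    ∀ k → 1 ℕ.≤ k → (∀ p e → Prime p → 1 ℕ.≤ e → p ℕ.^ e ℕ.∣ k → P (p ℕ.^ e)) → P k
  prime-power-induction P P1 P* = <-rec _ go
    where
    go : ∀ k → (∀ {j} → j ℕ.< k → 1 ℕ.≤ j → (∀ p e → Prime p → 1 ℕ.≤ e → p ℕ.^ e ℕ.∣ j → P (p ℕ.^ e)) → P j) →
         1 ℕ.≤ k → (∀ p e → Prime p → 1 ℕ.≤ e → p ℕ.^ e ℕ.∣ k → P (p ℕ.^ e)) → P k
    go 1 rec _ h = P1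
    go k@(suc (suc _)) rec 1≤k h
      with p , pp , p∣k ← prime-divisor k (ℕ.s≤s (ℕ.s≤s ℕ.z≤n))
      with split-power p (prime⇒2≤ pp) k 1≤k
    ... | zero , m , eq , p∤m = contradiction (subst (p ℕ.∣_) (trans eq (ℕ.*-identityˡ m)) p∣k) p∤m
    ... | suc e , m , eq , p∤m = subst P (sym eq) (P* coprime
        (h p (suc e) pp (ℕ.s≤s ℕ.z≤n) (subst (p ℕ.^ suc e ℕ.∣_) (sym eq) (ℕ.m∣m*n m)))
        (rec m<k 1≤m λ q f qq 1≤f q^f∣m → h q f qq 1≤f (subst (q ℕ.^ f ℕ.∣_) (sym eq) (ℕ.∣n⇒∣m*n (p ℕ.^ suc e) q^f∣m))))
      where
      coprime : Coprime (p ℕ.^ suc e) m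
      coprime = coprime-^ (Coprime.sym (prime-∤⇒coprime pp p∤m)) (suc e)
      1≤m : 1 ℕ.≤ m
      1≤m = m*n≥1⇒n≥1 (p ℕ.^ suc e) m (subst (1 ℕ.≤_) eq 1≤k)
      m<k : m ℕ.< k
      m<k = subst (m ℕ.<_) (trans (ℕ.*-comm m _) (sym eq))
        (ℕ.m<m*n m _ {{ℕ.>-nonZero 1≤m}} (ℕ.<-≤-trans (prime⇒2≤ pp)
          (subst (ℕ._≤ p ℕ.^ suc e) (ℕ.*-identityʳ p) (ℕ.^-monoʳ-≤ p {{prime⇒nonZero pp}} {1} {suc e} (ℕ.s≤s ℕ.z≤n)))))

  -- Universal forms and Hensel lifting

  Universal : BinaryQuadraticForm → ℕ → Set
  Universal Q k = ∀ l → ∃[ x ] ∃[ y ] eval Q x y ≡ l [mod k ]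

  eval-cong : ∀ Q x x′ y y′ {k} → x ≡ x′ [mod k ] → y ≡ y′ [mod k ] →
              eval Q x y ≡ eval Q x′ y′ [mod k ]
  eval-cong (form a b c) x x′ y y′ x≡x′ y≡y′ = ∣-combine x≡x′ y≡y′
    (a * (x + x′) + b * y) (b * x′ + c * (y + y′)) (identity a b c x x′ y y′)
    where
    identity : ∀ a b c x x′ y y′ →
      a * x * x + b * x * y + c * y * y - (a * x′ * x′ + b * x′ * y′ + c * y′ * y′) ≡
      (a * (x + x′) + b * y) * (x - x′) + (b * x′ + c * (y + y′)) * (y - y′)
    identity = solve-∀

  ≡-mod-sym : ∀ {k} i j → i ≡ j [mod k ] → j ≡ i [mod k ]
  ≡-mod-sym i j h = ∣-*ˡ h -1ℤ (identity i j)
    where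
    identity : ∀ i j → j - i ≡ -1ℤ * (i - j)
    identity = solve-∀

  ≡-mod-trans : ∀ {k} i j l → i ≡ j [mod k ] → j ≡ l [mod k ] → i ≡ l [mod k ]
  ≡-mod-trans i j l h h′ = ∣-combine h h′ 1ℤ 1ℤ (identity i j l)
    where
    identity : ∀ i j l → i - l ≡ 1ℤ * (i - j) + 1ℤ * (j - l)
    identity = solve-∀

  crt : ∀ {m n} → Coprime m n → ∀ i j → ∃[ z ] z ≡ i [mod m ] × z ≡ j [mod n ]
  crt {m} {n} c i j with u , v , eq ← bézout c =
    j * (u * + m) + i * (v * + n) , divides (u * (j - i)) (id₁ (+ m) (+ n) u v eq) ,
    divides (v * (i - j)) (id₂ (+ m) (+ n) u v eq)
    where
    open ≡-Reasoning
    id₁ : ∀ m n u v → u * m + v * n ≡ 1ℤ → j * (u * m) + i * (v * n) - i ≡ u * (j - i) * m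
    id₁ m n u v eq = begin
      j * (u * m) + i * (v * n) - i                         ≡⟨ lemma i j (u * m) (v * n) ⟩
      (j - i) * (u * m) + i * (u * m + v * n - 1ℤ)          ≡⟨ cong (λ z → (j - i) * (u * m) + i * (z - 1ℤ)) eq ⟩
      (j - i) * (u * m) + i * (1ℤ - 1ℤ)                     ≡⟨ lemma′ i j u m ⟩
      u * (j - i) * m                                       ∎
      where
      lemma : ∀ i j a b → j * a + i * b - i ≡ (j - i) * a + i * (a + b - 1ℤ)
      lemma = solve-∀
      lemma′ : ∀ i j u m → (j - i) * (u * m) + i * 0ℤ ≡ u * (j - i) * m
      lemma′ = solve-∀
    id₂ : ∀ m n u v → u * m + v * n ≡ 1ℤ → j * (u * m) + i * (v * n) - j ≡ v * (i - j) * n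
    id₂ m n u v eq = begin
      j * (u * m) + i * (v * n) - j                         ≡⟨ lemma i j (u * m) (v * n) ⟩
      (i - j) * (v * n) + j * (u * m + v * n - 1ℤ)          ≡⟨ cong (λ z → (i - j) * (v * n) + j * (z - 1ℤ)) eq ⟩
      (i - j) * (v * n) + j * (1ℤ - 1ℤ)                     ≡⟨ lemma′ i j v n ⟩
      v * (i - j) * n                                       ∎
      where
      lemma : ∀ i j a b → j * a + i * b - j ≡ (i - j) * b + j * (a + b - 1ℤ)
      lemma = solve-∀
      lemma′ : ∀ i j v n → (i - j) * (v * n) + j * 0ℤ ≡ v * (i - j) * n
      lemma′ = solve-∀

  universal-* : ∀ Q {m n} → Coprime m n → Universal Q m → Universal Q n → Universal Q (m ℕ.* n)
  universal-* Q {m} {n} c um un l =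
    let x₁ , y₁ , e₁    = um l
        x₂ , y₂ , e₂    = un l
        x , x≡x₁ , x≡x₂ = crt c x₁ x₂
        y , y≡y₁ , y≡y₂ = crt c y₁ y₂
    in x , y , coprime-*-∣ c
      (≡-mod-trans (eval Q x y) (eval Q x₁ y₁) l (eval-cong Q x x₁ y y₁ x≡x₁ y≡y₁) e₁)
      (≡-mod-trans (eval Q x y) (eval Q x₂ y₂) l (eval-cong Q x x₂ y y₂ x≡x₂ y≡y₂) e₂)

  universal-1 : ∀ Q → Universal Q 1
  universal-1 Q l = 0ℤ , 0ℤ , divides (eval Q 0ℤ 0ℤ - l) (sym (ℤ.*-identityʳ (eval Q 0ℤ 0ℤ - l)))

  infix 4 _∤⟨_,_⟩

  -- Nonvanishing of a vector modulo p, as a disjunction so that `newton-direction` can invert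
  -- whichever coordinate is a unit.
  _∤⟨_,_⟩ : ℕ → ℤ → ℤ → Set
  p ∤⟨ x , y ⟩ = ¬ + p ∣ x ⊎ ¬ + p ∣ y

  -- Nonzero vectors are the nonsingular points of Q modulo p when p ∤ disc Q; only these lift to higher powers of p.
  Lifts : BinaryQuadraticForm → ℕ → ℕ → Set
  Lifts Q p m = ∀ l → ∃[ x ] ∃[ y ] p ∤⟨ x , y ⟩ × eval Q x y ≡ l [mod m ]

  ∤-+ : ∀ {k i j} → ¬ k ∣ i → k ∣ j → ¬ k ∣ i + j
  ∤-+ k∤i k∣j k∣i+j = k∤i (∣m+n∣n⇒∣m k∣i+j k∣j)

  ∂x ∂y : BinaryQuadraticForm → ℤ → ℤ → ℤ
  ∂x (form a b c) x y = + 2 * a * x + b * y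
  ∂y (form a b c) x y = b * x + + 2 * c * y

  -- Exact Taylor expansion, since a quadratic form has no terms beyond second order. The linear
  -- term cancels q modulo p, and the quadratic one carries m * m, a multiple of p * m because p
  -- divides m.
  newton-step : ∀ Q x y s t q m l z p w →
    eval Q x y - l ≡ q * m → q + (s * ∂x Q x y + t * ∂y Q x y) ≡ w * p → m ≡ z * p →
    eval Q (x + m * s) (y + m * t) - l ≡ (w + z * eval Q s t) * (p * m)
  newton-step Q@(form a b c) x y s t q m l z p w eq eq′ m≡zp = begin
    eval Q (x + m * s) (y + m * t) - l
      ≡⟨ expand a b c x y s t m l ⟩
    (eval Q x y - l) + m * (s * ∂x Q x y + t * ∂y Q x y) + m * m * eval Q s t
      ≡⟨ cong (λ i → i + m * (s * ∂x Q x y + t * ∂y Q x y) + m * m * eval Q s t) eq ⟩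
    q * m + m * (s * ∂x Q x y + t * ∂y Q x y) + m * m * eval Q s t
      ≡⟨ collect q m (s * ∂x Q x y + t * ∂y Q x y) (eval Q s t) ⟩
    m * (q + (s * ∂x Q x y + t * ∂y Q x y)) + m * m * eval Q s t
      ≡⟨ cong₂ (λ i j → m * i + m * j * eval Q s t) eq′ m≡zp ⟩
    m * (w * p) + m * (z * p) * eval Q s t
      ≡⟨ factor w z m p (eval Q s t) ⟩
    (w + z * eval Q s t) * (p * m) ∎
    where
    open ≡-Reasoning
    expand : ∀ a b c x y s t m l →
      a * (x + m * s) * (x + m * s) + b * (x + m * s) * (y + m * t) + c * (y + m * t) * (y + m * t) - l ≡
      (a * x * x + b * x * y + c * y * y - l) + m * (s * (+ 2 * a * x + b * y) + t * (b * x + + 2 * c * y)) +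
      m * m * (a * s * s + b * s * t + c * t * t)
    expand = solve-∀
    collect : ∀ q m g e → q * m + m * g + m * m * e ≡ m * (q + g) + m * m * e
    collect = solve-∀
    factor : ∀ w z m p e → m * (w * p) + m * (z * p) * e ≡ (w + z * e) * (p * m)
    factor = solve-∀

  -- Solves ⟨gradient, (s, t)⟩ ≡ - q: the Hessian of Q has determinant - disc Q, a unit modulo p.
  newton-direction : ∀ Q {p} → Prime p → ¬ + p ∣ disc Q → ∀ q {x y} → p ∤⟨ x , y ⟩ →
    ∃[ s ] ∃[ t ] + p ∣ q + (s * ∂x Q x y + t * ∂y Q x y)
  newton-direction Q@(form a b c) pp p∤Δ q {x} {y} (inj₁ p∤x) =
    let v , e = inverse pp (disc Q * x) (∤-* pp p∤Δ p∤x)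
    -- Cramer's rule: `2c * ∂x - b * ∂y = - disc Q * x`. Scaling by `v * q`, with `v` inverse to
    -- `disc Q * x`, gives `- q`. The other case uses `- b * ∂x + 2a * ∂y = - disc Q * y`.
    in + 2 * c * v * q , - b * v * q , ∣-*ˡ e (- q) (identity (∂x Q x y) (∂y Q x y) (disc Q) v refl refl refl)
    where
    lemma : ∀ a b c x y v q →
      q + (+ 2 * c * v * q * (+ 2 * a * x + b * y) + - b * v * q * (b * x + + 2 * c * y)) ≡
      - q * (v * ((b * b - + 4 * a * c) * x) - 1ℤ)
    lemma = solve-∀
    identity : ∀ gx gy Δ v → gx ≡ + 2 * a * x + b * y → gy ≡ b * x + + 2 * c * y → Δ ≡ b * b - + 4 * a * c →
      q + (+ 2 * c * v * q * gx + - b * v * q * gy) ≡ - q * (v * (Δ * x) - 1ℤ)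
    identity gx gy Δ v refl refl refl = lemma a b c x y v q
  newton-direction Q@(form a b c) pp p∤Δ q {x} {y} (inj₂ p∤y) =
    let v , e = inverse pp (disc Q * y) (∤-* pp p∤Δ p∤y)
    in - b * v * q , + 2 * a * v * q , ∣-*ˡ e (- q) (identity (∂x Q x y) (∂y Q x y) (disc Q) v refl refl refl)
    where
    lemma : ∀ a b c x y v q →
      q + (- b * v * q * (+ 2 * a * x + b * y) + + 2 * a * v * q * (b * x + + 2 * c * y)) ≡
      - q * (v * ((b * b - + 4 * a * c) * y) - 1ℤ)
    lemma = solve-∀
    identity : ∀ gx gy Δ v → gx ≡ + 2 * a * x + b * y → gy ≡ b * x + + 2 * c * y → Δ ≡ b * b - + 4 * a * c →
      q + (- b * v * q * gx + + 2 * a * v * q * gy) ≡ - q * (v * (Δ * y) - 1ℤ)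
    identity gx gy Δ v refl refl refl = lemma a b c x y v q

  ∤-translate : ∀ {p m x y} → + p ∣ m → ∀ s t → p ∤⟨ x , y ⟩ → p ∤⟨ x + m * s , y + m * t ⟩
  ∤-translate p∣m s t (inj₁ p∤x) = inj₁ (∤-+ p∤x (∣m⇒∣m*n s p∣m))
  ∤-translate p∣m s t (inj₂ p∤y) = inj₂ (∤-+ p∤y (∣m⇒∣m*n t p∣m))

  hensel-step : ∀ Q {p m} → Prime p → ¬ + p ∣ disc Q → p ℕ.∣ m → Lifts Q p m → Lifts Q p (p ℕ.* m)
  hensel-step Q {p} {m} pp p∤Δ p∣m lifts l =
    let x , y , nz , divides q eq   = lifts l
        s , t , divides w eq′       = newton-direction Q pp p∤Δ q nz
        p∣+m                        = ∣⇒+∣+ p∣m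
        divides z m≡zp              = p∣+m
    in x + + m * s , y + + m * t , ∤-translate p∣+m s t nz ,
       divides (w + z * eval Q s t) (trans (newton-step Q x y s t q (+ m) l z (+ p) w eq eq′ m≡zp)
         (cong ((w + z * eval Q s t) *_) (sym (ℤ.pos-* p m))))

  hensel : ∀ Q {p} → Prime p → ¬ + p ∣ disc Q → Lifts Q p p → ∀ e → 1 ℕ.≤ e → Universal Q (p ℕ.^ e)
  hensel Q {p} pp p∤Δ lifts (suc e) _ l = let x , y , _ , h = go e l in x , y , h
    where
    -- The induction starts at exponent 1 because `hensel-step` requires p to divide the current
    -- modulus.
    go : ∀ e → Lifts Q p (p ℕ.^ suc e)
    go zero    = subst (Lifts Q p) (sym (ℕ.*-identityʳ p)) lifts
    go (suc e) = hensel-step Q pp p∤Δ (ℕ.m∣m*n (p ℕ.^ e)) (go e)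

  -- Squares modulo an odd prime

  ∣-combine₃ : ∀ {m u v w} → m ∣ u → m ∣ v → m ∣ w → ∀ A B C {X} → X ≡ A * u + B * v + C * w → m ∣ X
  ∣-combine₃ m∣u m∣v m∣w A B C refl =
    ∣m∣n⇒∣m+n (∣m∣n⇒∣m+n (∣n⇒∣m*n A m∣u) (∣n⇒∣m*n B m∣v)) (∣n⇒∣m*n C m∣w)

  even⊎odd : ∀ n → ∃[ h ] (n ≡ h ℕ.+ h ⊎ n ≡ suc (h ℕ.+ h))
  even⊎odd zero = 0 , inj₁ refl
  even⊎odd (suc n) with even⊎odd n
  ... | h , inj₁ refl = h , inj₂ refl
  ... | h , inj₂ refl = suc h , inj₁ (cong suc (sym (ℕ.+-suc h h)))

  2∣h+h : ∀ h → 2 ℕ.∣ h ℕ.+ h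
  2∣h+h h = ℕ.divides h (trans (cong (h ℕ.+_) (sym (ℕ.+-identityʳ h))) (ℕ.*-comm 2 h))

  half : ∀ {n} → Odd n → ∃[ h ] n ≡ suc (h ℕ.+ h)
  half {n} odd with even⊎odd n
  ... | h , inj₁ refl = contradiction (2∣h+h h) odd
  ... | h , inj₂ eq   = h , eq

  small-∣ : ∀ {p i} → + p ∣ i → ℤ.∣ i ∣ ℕ.< p → i ≡ 0ℤ
  small-∣ {p} {i} p∣i i<p with ℤ.∣ i ∣ in eq | ∣⇒∣ᵤ p∣i
  ... | zero  | _ = ℤ.∣i∣≡0⇒i≡0 eq
  ... | suc n | h = contradiction h (ℕ.>⇒∤ i<p)

  -- Both factors of a² - b² are below p in absolute value, so the one divisible by p vanishes; a +
  -- b = 0 leaves only a = b = 0.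
  square-injective : ∀ {p} → Prime p → ∀ a b → a ℕ.+ b ℕ.< p → + a * + a ≡ + b * + b [mod p ] → a ≡ b
  square-injective {p} pp a b a+b<p h = [ difference , sum ]′ (euclid pp (+ a - + b) (+ a + + b)
      (subst (+ p ∣_) (factor (+ a) (+ b)) h))
    where
    factor : ∀ a b → a * a - b * b ≡ (a - b) * (a + b)
    factor = solve-∀
    difference : + p ∣ + a - + b → a ≡ b
    difference h = ℤ.+-injective (ℤ.i-j≡0⇒i≡j (+ a) (+ b)
      (small-∣ h (ℕ.≤-<-trans (ℤ.∣i-j∣≤∣i∣+∣j∣ (+ a) (+ b)) a+b<p)))
    sum : + p ∣ + a + + b → a ≡ b
    sum h = trans (ℕ.m+n≡0⇒m≡0 a a+b≡0) (sym (ℕ.m+n≡0⇒n≡0 a a+b≡0))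
      where
      a+b≡0 : a ℕ.+ b ≡ 0
      a+b≡0 = ℤ.+-injective (small-∣ h a+b<p)

  residue≡⇒≡-mod : ∀ k .{{_ : NonZero k}} i j → proj₁ (residue k i) ≡ proj₁ (residue k j) → i ≡ j [mod k ]
  residue≡⇒≡-mod k i j eq = ≡-mod-trans i (+ toℕ r) j (≡-mod-sym (+ toℕ r) i (proj₂ (residue k i)))
    (subst (λ r → + toℕ r ≡ j [mod k ]) (sym eq) (proj₂ (residue k j)))
    where
    r = proj₁ (residue k i)

  -- The h + 1 values x² and the h + 1 values w + δy² with 0 ≤ x, y ≤ h cannot all be distinct modulo 2h + 1.
  norm-form-universal : ∀ {p} → OddPrime p → ∀ δ → ¬ + p ∣ δ → ∀ w → ∃[ x ] ∃[ y ] x * x - δ * (y * y) ≡ w [mod p ]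
  norm-form-universal {p} (pp , odd) δ p∤δ w =
    let i , j , i<j , same = Fin.pigeonhole p<2h+2 (λ i → proj₁ (residue p (value (split i))))
    in solution i j i<j (split i) (split j) refl refl
         (residue≡⇒≡-mod p (value (split i)) (value (split j)) same)
    where
    instance _ = prime⇒nonZero pp
    h = proj₁ (half odd)
    p≡1+2h = proj₂ (half odd)
    split : Fin (suc h ℕ.+ suc h) → Fin (suc h) ⊎ Fin (suc h)
    split = Fin.splitAt (suc h)
    value : Fin (suc h) ⊎ Fin (suc h) → ℤ
    value (inj₁ i) = + toℕ i * + toℕ i
    value (inj₂ j) = w + δ * (+ toℕ j * + toℕ j)
    p<2h+2 : p ℕ.< suc h ℕ.+ suc h
    p<2h+2 = subst (ℕ._< suc h ℕ.+ suc h) (sym p≡1+2h) (ℕ.≤-reflexive (sym (ℕ.+-suc (suc h) h)))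
    distinct : ∀ {i j} → i Fin.< j → ∀ s → split i ≡ s → split j ≡ s → ⊥
    distinct {i} {j} i<j s eq eq′ = Fin.<⇒≢ i<j (trans (sym (Fin.join-splitAt (suc h) (suc h) i))
      (trans (cong (Fin.join (suc h) (suc h)) (trans eq (sym eq′))) (Fin.join-splitAt (suc h) (suc h) j)))
    bounded : ∀ (a b : Fin (suc h)) → toℕ a ℕ.+ toℕ b ℕ.< p
    bounded a b = subst (toℕ a ℕ.+ toℕ b ℕ.<_) (sym p≡1+2h)
      (ℕ.s≤s (ℕ.+-mono-≤ (ℕ.s≤s⁻¹ (Fin.toℕ<n a)) (ℕ.s≤s⁻¹ (Fin.toℕ<n b))))
    same-square : ∀ (a b : Fin (suc h)) → + toℕ a * + toℕ a ≡ + toℕ b * + toℕ b [mod p ] → a ≡ b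
    same-square a b e = Fin.toℕ-injective (square-injective pp (toℕ a) (toℕ b) (bounded a b) e)
    sub : ∀ w δ x y → w + δ * x - (w + δ * y) ≡ δ * (x - y)
    sub = solve-∀
    move : ∀ w δ x y → x - δ * y - w ≡ 1ℤ * (x - (w + δ * y))
    move = solve-∀
    move′ : ∀ w δ x y → x - δ * y - w ≡ -1ℤ * (w + δ * y - x)
    move′ = solve-∀
    solution : ∀ i j → i Fin.< j → ∀ s t → split i ≡ s → split j ≡ t → value s ≡ value t [mod p ] →
      ∃[ x ] ∃[ y ] x * x - δ * (y * y) ≡ w [mod p ]
    -- A collision inside one half would identify i and j, because squares of 0, ..., h are distinct
    -- and δ is a unit. A collision across the halves is a solution.
    solution i j i<j (inj₁ a) (inj₁ b) eq eq′ e =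
      ⊥-elim (distinct i<j (inj₁ a) eq (trans eq′ (cong inj₁ (sym (same-square a b e)))))
    solution i j i<j (inj₂ a) (inj₂ b) eq eq′ e =
      ⊥-elim (distinct i<j (inj₂ a) eq (trans eq′ (cong inj₂ (sym (same-square a b
        (cancel-∣ pp p∤δ (subst (+ p ∣_) (sub w δ (+ toℕ a * + toℕ a) (+ toℕ b * + toℕ b)) e)))))))
    solution i j i<j (inj₁ a) (inj₂ b) _ _ e = + toℕ a , + toℕ b ,
      ∣-*ˡ e 1ℤ (move w δ (+ toℕ a * + toℕ a) (+ toℕ b * + toℕ b))
    solution i j i<j (inj₂ a) (inj₁ b) _ _ e = + toℕ b , + toℕ a ,
      ∣-*ˡ e -1ℤ (move′ w δ (+ toℕ b * + toℕ b) (+ toℕ a * + toℕ a))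

  -- The residues r and p - r have the same square, and one of them is at most h. Thus h + 1
  -- candidate roots suffice, which makes the count in `nonresidue-exists` succeed.
  square-reduce : ∀ {p} .{{_ : NonZero p}} {h} → p ≡ suc (h ℕ.+ h) → ∀ X →
    ∃[ x ] + toℕ {suc h} x * + toℕ x ≡ X * X [mod p ]
  square-reduce {p} {h} p≡1+2h X = reduce (r ℕ.≤? h)
    where
    r = toℕ (proj₁ (residue p X))
    r≤p : r ℕ.≤ p
    r≤p = ℕ.<⇒≤ (Fin.toℕ<n (proj₁ (residue p X)))
    r≡X : + r ≡ X [mod p ]
    r≡X = proj₂ (residue p X)
    factor : ∀ r X → r * r - X * X ≡ (r + X) * (r - X)
    factor = solve-∀
    factor′ : ∀ r s X → s * s - X * X ≡ (s - r) * (r + s) + (r + X) * (r - X)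
    factor′ = solve-∀
    Reduced : Set
    Reduced = ∃[ x ] + toℕ {suc h} x * + toℕ x ≡ X * X [mod p ]
    embed : ∀ s → s ℕ.≤ h → + s * + s ≡ X * X [mod p ] → Reduced
    embed s s≤h e = fromℕ< (ℕ.s≤s s≤h) , subst (λ t → + t * + t ≡ X * X [mod p ]) (sym (Fin.toℕ-fromℕ< (ℕ.s≤s s≤h))) e
    reduce : Dec (r ℕ.≤ h) → Reduced
    reduce (yes r≤h) = embed r r≤h (∣-*ˡ r≡X (+ r + X) (factor (+ r) X))
    reduce (no  r≰h) = embed (p ℕ.∸ r) s≤h (∣-combine p∣r+s r≡X (+ (p ℕ.∸ r) - + r) (+ r + X) (factor′ (+ r) (+ (p ℕ.∸ r)) X))
      where
      s≤h : p ℕ.∸ r ℕ.≤ h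
      s≤h = ℕ.≤-trans (ℕ.∸-monoʳ-≤ p (ℕ.≰⇒> r≰h))
        (ℕ.≤-reflexive (trans (cong (ℕ._∸ suc h) p≡1+2h) (ℕ.m+n∸m≡n h h)))
      p∣r+s : + p ∣ + (r ℕ.+ (p ℕ.∸ r))
      p∣r+s = subst (λ n → + p ∣ + n) (sym (ℕ.m+[n∸m]≡n r≤p)) ∣-refl

  -- X = 0 is included, so such a u is automatically nonzero modulo p.
  NonResidue : ℤ → ℕ → Set
  NonResidue u p = ∀ X → ¬ X * X ≡ u [mod p ]

  -- If all p = 2h + 1 residues had a root among 0, ..., h, two of them would share one, since h + 1
  -- < p once h ≥ 1; and h = 0 would make p = 1.
  nonresidue-exists : ∀ {p} → OddPrime p → ∃[ u ] NonResidue u p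
  nonresidue-exists {p} (pp , odd) =
    let u , ¬root = Fin.¬∀⟶∃¬ p HasRoot hasRoot? not-all
    in + toℕ u , λ X X²≡u →
         let x , x²≡X² = square-reduce p≡1+2h X
         in ¬root (x , ≡-mod-trans (+ toℕ x * + toℕ x) (X * X) (+ toℕ u) x²≡X² X²≡u)
    where
    instance _ = prime⇒nonZero pp
    h = proj₁ (half odd)
    p≡1+2h = proj₂ (half odd)
    HasRoot : Fin p → Set
    HasRoot u = ∃[ x ] + toℕ {suc h} x * + toℕ x ≡ + toℕ u [mod p ]
    hasRoot? : ∀ u → Dec (HasRoot u)
    hasRoot? u = Fin.any? λ x → + p ∣? + toℕ x * + toℕ x - + toℕ u
    h+1<p : suc h ℕ.< p
    h+1<p with h | p≡1+2h
    ... | zero  | refl = contradiction pp ¬prime[1]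
    ... | suc h | refl = ℕ.s≤s (ℕ.s≤s (ℕ.m≤n+m (suc h) h))
    not-all : ¬ (∀ u → HasRoot u)
    not-all roots =
      let u , v , u<v , same = Fin.pigeonhole h+1<p (λ u → proj₁ (roots u))
          x = proj₁ (roots u)
          v-root = subst (λ x → + toℕ x * + toℕ x ≡ + toℕ v [mod p ]) (sym same) (proj₂ (roots v))
          u≡v = ≡-mod-trans (+ toℕ u) (+ toℕ x * + toℕ x) (+ toℕ v)
            (≡-mod-sym (+ toℕ x * + toℕ x) (+ toℕ u) (proj₂ (roots u))) v-root
      in Fin.<⇒≢ u<v (Fin.toℕ-injective (≡-mod⇒≡ (toℕ u) (toℕ v) (Fin.toℕ<n u) (Fin.toℕ<n v) u≡v))
      where
      ≡-mod⇒≡ : ∀ i j → i ℕ.< p → j ℕ.< p → + i ≡ + j [mod p ] → i ≡ j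
      ≡-mod⇒≡ i j i<p j<p e = ℤ.+-injective (ℤ.i-j≡0⇒i≡j (+ i) (+ j) (small-∣ e
        (ℕ.≤-<-trans (ℕ.≤-trans (ℕ.≤-reflexive (cong ℤ.∣_∣ (ℤ.m-n≡m⊖n i j))) (ℤ.∣m⊝n∣≤m⊔n i j)) (ℕ.⊔-lub i<p j<p))))

  -- Forms modulo an odd prime

  swap : BinaryQuadraticForm → BinaryQuadraticForm
  swap (form a b c) = form c b a

  eval-swap : ∀ Q x y → eval Q x y ≡ eval (swap Q) y x
  eval-swap (form a b c) = identity a b c
    where
    identity : ∀ a b c x y → a * x * x + b * x * y + c * y * y ≡ c * y * y + b * y * x + a * x * x
    identity = solve-∀

  disc-swap : ∀ Q → disc (swap Q) ≡ disc Q
  disc-swap (form a b c) = identity a b c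
    where
    identity : ∀ a b c → b * b - + 4 * c * a ≡ b * b - + 4 * a * c
    identity = solve-∀

  universal-swap : ∀ Q {k} → Universal (swap Q) k → Universal Q k
  universal-swap Q {k} u l = let x , y , e = u l in y , x , subst (_≡ l [mod k ]) (sym (eval-swap Q y x)) e

  obstruction-swap : ∀ Q {k} → HasLocalObstruction (swap Q) k → HasLocalObstruction Q k
  obstruction-swap Q {k} (l , none) = l , λ x y e → none y x (subst (_≡ l [mod k ]) (eval-swap Q x y) e)

  universal⇒¬obstruction : ∀ Q {k} → Universal Q k → ¬ HasLocalObstruction Q k
  universal⇒¬obstruction Q u (l , none) = let x , y , e = u l in none x y e

  primitive-∤ : ∀ a b c → Primitive (form a b c) → ∀ {p} → Prime p → + p ∣ a → + p ∣ b → ¬ + p ∣ c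
  primitive-∤ a b c prim {p} pp p∣a p∣b p∣c = prime⇒∤1 pp (subst (+ p ∣_) prim
    (∣ᵤ⇒∣ {+ p} {gcd (gcd a b) c} (gcd-greatest {gcd a b} {c} {+ p}
      (gcd-greatest {a} {b} {+ p} (∣⇒∣ᵤ p∣a) (∣⇒∣ᵤ p∣b)) (∣⇒∣ᵤ p∣c))))

  oddPrime-∤2 : ∀ {p} → OddPrime p → ¬ + p ∣ + 2
  oddPrime-∤2 {p} (pp , odd) p∣2 with ℕ.m≤n⇒m<n∨m≡n (ℕ.∣⇒≤ (+∣+⇒∣ p∣2))
  ... | inj₁ p<2  = contradiction (prime⇒2≤ pp) (ℕ.<⇒≱ p<2)
  ... | inj₂ refl = odd ℕ.∣-refl

  -- The partial derivative `∂x` doubles as the linear form 2ax + by of the completed square.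
  complete-square : ∀ a b c x y → let Q = form a b c in
    + 4 * a * eval Q x y ≡ ∂x Q x y * ∂x Q x y - disc Q * (y * y)
  complete-square a b c x y = identity (eval (form a b c) x y) (∂x (form a b c) x y) (disc (form a b c)) refl refl refl
    where
    lemma : ∀ a b c x y → + 4 * a * (a * x * x + b * x * y + c * y * y) ≡
      (+ 2 * a * x + b * y) * (+ 2 * a * x + b * y) - (b * b - + 4 * a * c) * (y * y)
    lemma = solve-∀
    identity : ∀ q g Δ → q ≡ a * x * x + b * x * y + c * y * y → g ≡ + 2 * a * x + b * y → Δ ≡ b * b - + 4 * a * c →
      + 4 * a * q ≡ g * g - Δ * (y * y)
    identity q g Δ refl refl refl = lemma a b c x y

  ∤-2* : ∀ {p} → OddPrime p → ∀ {a} → ¬ + p ∣ a → ¬ + p ∣ + 2 * a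
  ∤-2* op p∤a = ∤-* (proj₁ op) (oddPrime-∤2 op) p∤a

  ∤-4* : ∀ {p} → OddPrime p → ∀ {a} → ¬ + p ∣ a → ¬ + p ∣ + 4 * a
  ∤-4* op p∤a = ∤-* (proj₁ op) (∤-* (proj₁ op) (oddPrime-∤2 op) (oddPrime-∤2 op)) p∤a

  -- Solve X² - ΔY² ≡ 4al, pull back along X = 2ax + bY, which can be solved for x because 2a is a
  -- unit modulo p, and cancel 4a.
  universal-unit : ∀ a b c {p} → OddPrime p → ¬ + p ∣ disc (form a b c) → ¬ + p ∣ a → Universal (form a b c) p
  universal-unit a b c {p} op@(pp , _) p∤Δ p∤a l =
    let X , Y , e = norm-form-universal op (disc Q) p∤Δ (+ 4 * a * l)
        v , e′    = inverse pp (+ 2 * a) (∤-2* op p∤a)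
        x         = v * (X - b * Y)
    in x , Y , cancel-∣ pp (∤-4* op p∤a) (∣-combine e′ e ((X - b * Y) * (∂x Q x Y + X)) 1ℤ
         (identity X Y v (eval Q x Y) (∂x Q x Y) (disc Q) (complete-square a b c x Y) refl))
    where
    Q = form a b c
    lemma : ∀ a b X Y v l Δ →
      (+ 2 * a * (v * (X - b * Y)) + b * Y) * (+ 2 * a * (v * (X - b * Y)) + b * Y) - Δ * (Y * Y) + + 4 * a * (- l) ≡
      (X - b * Y) * (+ 2 * a * (v * (X - b * Y)) + b * Y + X) * (v * (+ 2 * a) - 1ℤ) +
      1ℤ * (X * X - Δ * (Y * Y) - + 4 * a * l)
    lemma = solve-∀
    identity : ∀ X Y v q g Δ → + 4 * a * q ≡ g * g - Δ * (Y * Y) → g ≡ + 2 * a * (v * (X - b * Y)) + b * Y →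
      + 4 * a * (q - l) ≡ (X - b * Y) * (g + X) * (v * (+ 2 * a) - 1ℤ) + 1ℤ * (X * X - Δ * (Y * Y) - + 4 * a * l)
    identity X Y v q g Δ eq refl = trans (ℤ.*-distribˡ-+ (+ 4 * a) q (- l))
      (trans (cong (_+ + 4 * a * (- l)) eq) (lemma a b X Y v l Δ))

  -- Modulo p the form is bxy, so x = 1 and y = l / b represent l. This is the case in which no
  -- square can be completed.
  universal-isotropic-axes : ∀ a b c {p} → Prime p → + p ∣ a → + p ∣ c → ¬ + p ∣ b → Universal (form a b c) p
  universal-isotropic-axes a b c pp p∣a p∣c p∤b l =
    let v , e = inverse pp b p∤b
    in 1ℤ , v * l , ∣-combine₃ p∣a e p∣c 1ℤ l (v * l * (v * l)) (identity a b c v l)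
    where
    identity : ∀ a b c v l → a * 1ℤ * 1ℤ + b * 1ℤ * (v * l) + c * (v * l) * (v * l) - l ≡
      1ℤ * a + l * (v * b - 1ℤ) + v * l * (v * l) * c
    identity = solve-∀

  p∣b∧p∣a⇒p∣Δ : ∀ a b c {p} → + p ∣ b → + p ∣ a → + p ∣ disc (form a b c)
  p∣b∧p∣a⇒p∣Δ a b c p∣b p∣a = ∣-combine p∣b p∣a b (- + 4 * c) (identity a b c)
    where
    identity : ∀ a b c → b * b - + 4 * a * c ≡ b * b + - + 4 * c * a
    identity = solve-∀

  universal-odd-prime : ∀ Q {p} → OddPrime p → ¬ + p ∣ disc Q → Universal Q p
  universal-odd-prime Q@(form a b c) {p} op p∤Δ = go (+ p ∣? a) (+ p ∣? c)
    where
    go : Dec (+ p ∣ a) → Dec (+ p ∣ c) → Universal Q p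
    go (no p∤a)  _         = universal-unit a b c op p∤Δ p∤a
    go (yes _)   (no p∤c)  = universal-swap Q (universal-unit c b a op (λ h → p∤Δ (subst (+ p ∣_) (disc-swap Q) h)) p∤c)
    go (yes p∣a) (yes p∣c) = universal-isotropic-axes a b c (proj₁ op) p∣a p∣c λ p∣b → p∤Δ (p∣b∧p∣a⇒p∣Δ a b c p∣b p∣a)

  eval-∣ : ∀ Q {m x y} → m ∣ x → m ∣ y → m ∣ eval Q x y
  eval-∣ (form a b c) {x = x} {y} m∣x m∣y =
    ∣m∣n⇒∣m+n (∣m∣n⇒∣m+n (∣n⇒∣m*n (a * x) m∣x) (∣n⇒∣m*n (b * x) m∣y)) (∣n⇒∣m*n (c * y) m∣y)

  Isotropic : BinaryQuadraticForm → ℕ → Set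
  Isotropic Q p = ∃[ x ] ∃[ y ] p ∤⟨ x , y ⟩ × + p ∣ eval Q x y

  -- When p does not divide l, any solution is nonzero modulo p. For l ≡ 0 universality may only
  -- offer the zero vector, so the isotropic vector takes its place.
  universal∧isotropic⇒lifts : ∀ Q {p} → Universal Q p → Isotropic Q p → Lifts Q p p
  universal∧isotropic⇒lifts Q {p} universal (x₀ , y₀ , nz , p∣Q) l = go (+ p ∣? l)
    where
    Solution : Set
    Solution = ∃[ x ] ∃[ y ] p ∤⟨ x , y ⟩ × eval Q x y ≡ l [mod p ]
    nonzero : ∀ x y → eval Q x y ≡ l [mod p ] → ¬ + p ∣ l → Dec (+ p ∣ x) → Dec (+ p ∣ y) → p ∤⟨ x , y ⟩
    nonzero x y e p∤l (no p∤x) _         = inj₁ p∤x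
    nonzero x y e p∤l (yes _) (no p∤y)   = inj₂ p∤y
    nonzero x y e p∤l (yes p∣x) (yes p∣y) =
      contradiction (∣-combine (eval-∣ Q p∣x p∣y) e 1ℤ -1ℤ (identity (eval Q x y) l)) p∤l
      where
      identity : ∀ q l → l ≡ 1ℤ * q + -1ℤ * (q - l)
      identity = solve-∀
    go : Dec (+ p ∣ l) → Solution
    go (yes p∣l) = x₀ , y₀ , nz , ∣m∣n⇒∣m-n p∣Q p∣l
    go (no p∤l)  = let x , y , e = universal l in x , y , nonzero x y e p∤l (+ p ∣? x) (+ p ∣? y) , e

  -- The Legendre symbol and isotropic vectors modulo an odd prime

  private
    -- The body of `legendre` with its two decisions abstracted: the case analysis matches on
    -- arbitrary deciders, and the results apply to `legendre` by unfolding.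
    symbol : ∀ {A B : Set} → Dec A → Dec B → ℤ
    symbol d e = if does d then 0ℤ else if does e then 1ℤ else -1ℤ

    symbol≡-1⇒ : ∀ {A B : Set} (d : Dec A) (e : Dec B) → symbol d e ≡ -1ℤ → ¬ A × ¬ B
    symbol≡-1⇒ (no ¬a) (no ¬b) _ = ¬a , ¬b
    symbol≡-1⇒ (yes _) _ ()
    symbol≡-1⇒ (no _) (yes _) ()

    symbol≡-1 : ∀ {A B : Set} (d : Dec A) (e : Dec B) → ¬ A → ¬ B → symbol d e ≡ -1ℤ
    symbol≡-1 (no _)  (no _)  _ _ = refl
    symbol≡-1 (yes a) _       ¬a _ = contradiction a ¬a
    symbol≡-1 (no _)  (yes b) _ ¬b = contradiction b ¬b

    symbol≢-1 : ∀ {A B : Set} (d : Dec A) (e : Dec B) → ¬ A → symbol d e ≢ -1ℤ → B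
    symbol≢-1 (yes a) _       ¬a _   = contradiction a ¬a
    symbol≢-1 (no _)  (yes b) _ _    = b
    symbol≢-1 (no _)  (no _)  _ ≢-1 = contradiction refl ≢-1

  module _ (i : ℤ) (p : ℕ) where
    private
      root? : Dec (∃[ x ] + p ∣ + toℕ {p} x * + toℕ x - i)
      root? = Fin.any? λ x → + p ∣? + toℕ x * + toℕ x - i

    legendre≡-1⇒nonresidue : .{{_ : NonZero p}} → legendre i p ≡ -1ℤ → ¬ + p ∣ i × NonResidue i p
    legendre≡-1⇒nonresidue eq =
      let p∤i , ¬root = symbol≡-1⇒ (+ p ∣? i) root? eq
      in p∤i , λ X X²≡i →
           let x , x≡X = residue p X
           in ¬root (x , ∣-combine x≡X X²≡i (+ toℕ x + X) 1ℤ (identity (+ toℕ x) X i))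
      where
      identity : ∀ x X i → x * x - i ≡ (x + X) * (x - X) + 1ℤ * (X * X - i)
      identity = solve-∀

    nonresidue⇒legendre≡-1 : ¬ + p ∣ i → NonResidue i p → legendre i p ≡ -1ℤ
    nonresidue⇒legendre≡-1 p∤i nonres = symbol≡-1 (+ p ∣? i) root? p∤i λ (x , e) → nonres (+ toℕ x) e

    legendre≢-1⇒square : ¬ + p ∣ i → legendre i p ≢ -1ℤ → ∃[ s ] s * s ≡ i [mod p ]
    legendre≢-1⇒square p∤i ≢-1 = let x , e = symbol≢-1 (+ p ∣? i) root? p∤i ≢-1 in + toℕ x , e

  -- The quadratic formula in homogeneous form, x : y = (s - b) : 2a. Its second coordinate is a
  -- unit unless p divides a, and then (1, 0) is isotropic.
  square-disc⇒isotropic : ∀ Q {p} → OddPrime p → ∀ s → s * s ≡ disc Q [mod p ] → Isotropic Q p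
  square-disc⇒isotropic Q@(form a b c) {p} op s e = go (+ p ∣? a)
    where
    at-axis : ∀ a b c → a * 1ℤ * 1ℤ + b * 1ℤ * 0ℤ + c * 0ℤ * 0ℤ ≡ 1ℤ * a
    at-axis = solve-∀
    at-root : ∀ a b c s → a * (s - b) * (s - b) + b * (s - b) * (+ 2 * a) + c * (+ 2 * a) * (+ 2 * a) ≡
      a * (s * s - (b * b - + 4 * a * c))
    at-root = solve-∀
    go : Dec (+ p ∣ a) → Isotropic Q p
    go (yes p∣a) = 1ℤ , 0ℤ , inj₁ (prime⇒∤1 (proj₁ op)) , ∣-*ˡ p∣a 1ℤ (at-axis a b c)
    go (no  p∤a) = s - b , + 2 * a , inj₂ (∤-2* op p∤a) , ∣-*ˡ e a (at-root a b c s)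

  -- Obstructions at ramified and inert primes

  obstruction-ramified-unit : ∀ a b c {p} → OddPrime p → + p ∣ disc (form a b c) → ¬ + p ∣ a →
    HasLocalObstruction (form a b c) p
  obstruction-ramified-unit a b c {p} op@(pp , _) p∣Δ p∤a =
    let u , nonres = nonresidue-exists op
        v , e′     = inverse pp (+ 2 * a) (∤-2* op p∤a)
    -- Q ≡ au gives (2ax + by)² ≡ 4a²u, so u would be the square of (2ax + by) / 2a; `v` is the
    -- inverse of 2a.
    in a * u , λ x y e → nonres (v * ∂x Q x y)
         (∣-combine₃ e p∣Δ e′ (v * v * (+ 4 * a)) (v * v * (y * y)) (u * (v * (+ 2 * a) + 1ℤ))
           (identity (eval Q x y) (∂x Q x y) (disc Q) y u v (complete-square a b c x y)))
    where
    Q = form a b c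
    lemma : ∀ a g Δ y u v → v * g * (v * g) - u ≡
      v * v * (g * g - Δ * (y * y)) + v * v * (+ 4 * a) * (- (a * u)) + v * v * (y * y) * Δ +
      u * (v * (+ 2 * a) + 1ℤ) * (v * (+ 2 * a) - 1ℤ)
    lemma = solve-∀
    lemma′ : ∀ a q u v → v * v * (+ 4 * a * q) + v * v * (+ 4 * a) * (- (a * u)) ≡ v * v * (+ 4 * a) * (q - a * u)
    lemma′ = solve-∀
    identity : ∀ q g Δ y u v → + 4 * a * q ≡ g * g - Δ * (y * y) → v * g * (v * g) - u ≡
      v * v * (+ 4 * a) * (q - a * u) + v * v * (y * y) * Δ + u * (v * (+ 2 * a) + 1ℤ) * (v * (+ 2 * a) - 1ℤ)
    identity q g Δ y u v eq = trans (lemma a g Δ y u v)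
      (cong (λ z → z + v * v * (y * y) * Δ + u * (v * (+ 2 * a) + 1ℤ) * (v * (+ 2 * a) - 1ℤ))
        (trans (cong (λ z → v * v * z + v * v * (+ 4 * a) * (- (a * u))) (sym eq)) (lemma′ a q u v)))

  p∣Δ∧p∣a⇒p∣b : ∀ a b c {p} → Prime p → + p ∣ disc (form a b c) → + p ∣ a → + p ∣ b
  p∣Δ∧p∣a⇒p∣b a b c pp p∣Δ p∣a = ∣-square pp b (∣-combine p∣Δ p∣a 1ℤ (+ 4 * c) (identity a b c))
    where
    identity : ∀ a b c → b * b ≡ 1ℤ * (b * b - + 4 * a * c) + + 4 * c * a
    identity = solve-∀

  obstruction-ramified : ∀ Q → Primitive Q → ∀ {p} → OddPrime p → + p ∣ disc Q → HasLocalObstruction Q p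
  obstruction-ramified Q@(form a b c) prim {p} op@(pp , _) p∣Δ = go (+ p ∣? a)
    where
    go : Dec (+ p ∣ a) → HasLocalObstruction Q p
    go (no p∤a)  = obstruction-ramified-unit a b c op p∣Δ p∤a
    -- Here p divides b as well, because b² = Δ + 4ac, so by primitivity c is a unit.
    go (yes p∣a) = obstruction-swap Q (obstruction-ramified-unit c b a op
      (subst (+ p ∣_) (sym (disc-swap Q)) p∣Δ) (primitive-∤ a b c prim pp p∣a (p∣Δ∧p∣a⇒p∣b a b c pp p∣Δ p∣a)))

  -- A value ≡ p would be divisible by p, hence by p², forcing p² to divide p. The prime 2 is
  -- allowed: it yields the obstruction modulo 4 when Δ ≡ 5 (mod 8).
  anisotropic⇒obstruction : ∀ Q {p} → Prime p → (∀ x y → + p ∣ eval Q x y → + p ∣ x × + p ∣ y) →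
    HasLocalObstruction Q (p ℕ.^ 2)
  anisotropic⇒obstruction Q@(form a b c) {p} pp anisotropic = + p , λ x y e →
    let p∣x , p∣y = anisotropic x y (∣-combine (∣-trans p∣p² e) (∣-refl {+ p}) 1ℤ 1ℤ (split (eval Q x y) (+ p)))
    in ℕ.<⇒≱ p<p² (ℕ.∣⇒≤ {{prime⇒nonZero pp}} (+∣+⇒∣ (∣-combine (p²∣eval p∣x p∣y) e 1ℤ -1ℤ (split′ (eval Q x y) (+ p)))))
    where
    p∣p² : + p ∣ + (p ℕ.^ 2)
    p∣p² = ∣⇒+∣+ (ℕ.m∣m*n (p ℕ.* 1))
    p<p² : p ℕ.< p ℕ.^ 2
    p<p² = subst (p ℕ.<_) (cong (p ℕ.*_) (sym (ℕ.*-identityʳ p))) (ℕ.m<m*n p p {{prime⇒nonZero pp}} (prime⇒2≤ pp))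
    split : ∀ q p → q ≡ 1ℤ * (q - p) + 1ℤ * p
    split = solve-∀
    split′ : ∀ q p → p ≡ 1ℤ * q + -1ℤ * (q - p)
    split′ = solve-∀
    homogeneous : ∀ a b c x y p →
      a * (x * p) * (x * p) + b * (x * p) * (y * p) + c * (y * p) * (y * p) ≡
      (a * x * x + b * x * y + c * y * y) * (p * (p * 1ℤ))
    homogeneous = solve-∀
    p²∣eval : ∀ {x y} → + p ∣ x → + p ∣ y → + (p ℕ.^ 2) ∣ eval Q x y
    p²∣eval (divides x refl) (divides y refl) = divides (eval Q x y)
      (trans (homogeneous a b c x y (+ p)) (cong (eval Q x y *_)
        (trans (cong (+ p *_) (sym (ℤ.pos-* p 1))) (sym (ℤ.pos-* p (p ℕ.* 1))))))

  -- From 4aQ = g² - Δy² with g = 2ax + by: if y were a unit, Δ would be the square of g / y. So p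
  -- divides y, then g, then 2ax; and p cannot divide a, since then Δ ≡ b².
  inert⇒anisotropic : ∀ Q {p} → OddPrime p → NonResidue (disc Q) p →
    ∀ x y → + p ∣ eval Q x y → + p ∣ x × + p ∣ y
  inert⇒anisotropic Q@(form a b c) {p} op@(pp , _) nonres x y p∣Q = p∣x p∣y , p∣y
    where
    Δ = disc Q
    g = ∂x Q x y
    p∤a : ¬ + p ∣ a
    p∤a p∣a = nonres b (∣-*ˡ p∣a (+ 4 * c) (identity a b c))
      where
      identity : ∀ a b c → b * b - (b * b - + 4 * a * c) ≡ + 4 * c * a
      identity = solve-∀
    p∣norm : + p ∣ g * g - Δ * (y * y)
    p∣norm = subst (+ p ∣_) (complete-square a b c x y) (∣n⇒∣m*n (+ 4 * a) p∣Q)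
    p∣y : + p ∣ y
    p∣y = go (+ p ∣? y)
      where
      identity : ∀ g Δ y w → w * g * (w * g) - Δ ≡ w * w * (g * g - Δ * (y * y)) + Δ * (w * y + 1ℤ) * (w * y - 1ℤ)
      identity = solve-∀
      go : Dec (+ p ∣ y) → + p ∣ y
      go (yes h)  = h
      go (no p∤y) = let w , e = inverse pp y p∤y in
        ⊥-elim (nonres (w * g) (∣-combine p∣norm e (w * w) (Δ * (w * y + 1ℤ)) (identity g Δ y w)))
    p∣x : + p ∣ y → + p ∣ x
    p∣x p∣y = cancel-∣ pp (∤-2* op p∤a) (∣-combine p∣g p∣y 1ℤ (- b) (identity a b x y))
      where
      identity′ : ∀ g Δ y → g * g ≡ 1ℤ * (g * g - Δ * (y * y)) + Δ * y * y
      identity′ = solve-∀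
      identity : ∀ a b x y → + 2 * a * x ≡ 1ℤ * (+ 2 * a * x + b * y) + - b * y
      identity = solve-∀
      p∣g : + p ∣ g
      p∣g = ∣-square pp g (∣-combine p∣norm p∣y 1ℤ (Δ * y) (identity′ g Δ y))

  -- Forms modulo powers of two

  odd⇒square≡1 : ∀ i → ¬ + 2 ∣ i → i * i ≡ 1ℤ [mod 8 ]
  odd⇒square≡1 i 2∤i =
    let r , r≡i = residue 8 i
        2∣r-i   = ∣-trans (divides (+ 4) refl) r≡i
        2∤r     = λ 2∣r → 2∤i (∣-combine 2∣r 2∣r-i 1ℤ -1ℤ (difference (+ toℕ r) i))
    in ∣-combine (table r 2∤r) r≡i 1ℤ (- (i + + toℕ r)) (squares (+ toℕ r) i)
    where
    table : ∀ (r : Fin 8) → ¬ + 2 ∣ + toℕ r → + 8 ∣ + toℕ r * + toℕ r - 1ℤ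
    table = from-yes (Fin.all? λ (r : Fin 8) → ¬? (+ 2 ∣? + toℕ r) →-dec (+ 8 ∣? + toℕ r * + toℕ r - 1ℤ))
    difference : ∀ r i → i ≡ 1ℤ * r + -1ℤ * (r - i)
    difference = solve-∀
    squares : ∀ r i → i * i - 1ℤ ≡ 1ℤ * (r * r - 1ℤ) + - (i + r) * (r - i)
    squares = solve-∀

  odd-1 : ∀ i → ¬ + 2 ∣ i → + 2 ∣ i - 1ℤ
  odd-1 i 2∤i = cancel (euclid prime[2] (i - 1ℤ) (i + 1ℤ)
    (subst (+ 2 ∣_) (factor i) (∣-trans (divides (+ 4) refl) (odd⇒square≡1 i 2∤i))))
    where
    factor : ∀ i → i * i - 1ℤ ≡ (i - 1ℤ) * (i + 1ℤ)
    factor = solve-∀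
    shift : ∀ i → i - 1ℤ ≡ 1ℤ * (i + 1ℤ) + -1ℤ * + 2
    shift = solve-∀
    cancel : + 2 ∣ i - 1ℤ ⊎ + 2 ∣ i + 1ℤ → + 2 ∣ i - 1ℤ
    cancel (inj₁ h) = h
    cancel (inj₂ h) = ∣-combine h (∣-refl {+ 2}) 1ℤ -1ℤ (shift i)

  -- The norm form x² - dy² modulo 4 and 8

  norm : ℤ → ℤ → ℤ → ℤ
  norm d x y = x * x - d * (y * y)

  -- The coefficient d varies along with x and y, which reduces claims about every d to finite
  -- tables of residues.
  norm-cong : ∀ d d′ x x′ y y′ r {k} → d′ ≡ d [mod k ] → x′ ≡ x [mod k ] → y′ ≡ y [mod k ] →
    norm d x y ≡ r [mod k ] → norm d′ x′ y′ ≡ r [mod k ]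
  norm-cong d d′ x x′ y y′ r {k} ed ex ey e =
    subst (+ k ∣_) (sym (identity d d′ x x′ y y′ r)) (∣m∣n⇒∣m+n e
      (∣-combine₃ ed ex ey (- (y * y)) (x + x′) (- d′ * (y + y′)) refl))
    where
    identity : ∀ d d′ x x′ y y′ r → x′ * x′ - d′ * (y′ * y′) - r ≡
      x * x - d * (y * y) - r + (- (y * y) * (d′ - d) + (x + x′) * (x′ - x) + - d′ * (y + y′) * (y′ - y))
    identity = solve-∀

  MissedByNorm : ℤ → ℕ → Set
  MissedByNorm d k = ∃[ r ] (∀ x y → ¬ norm d x y ≡ r [mod k ])

  -- Odd values need x odd; modulo 8 they are then 1 or 7 if d ≡ 2, and 1 or 3 if d ≡ 6. The odd
  -- residue missed in both cases is 5.
  norm-mod8 : ∀ d → d ≡ + 2 [mod 4 ] → MissedByNorm d 8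
  norm-mod8 d d≡2 = + 5 , λ x y e →
    let r , r≡d = residue 8 d
        s , s≡x = residue 8 x
        t , t≡y = residue 8 y
    in table r (≡-mod-trans (+ toℕ r) d (+ 2) (∣-trans (divides (+ 2) refl) r≡d) d≡2) s t
         (norm-cong d (+ toℕ r) x (+ toℕ s) y (+ toℕ t) (+ 5) r≡d s≡x t≡y e)
    where
    table : ∀ (r : Fin 8) → + toℕ r ≡ + 2 [mod 4 ] → ∀ (s t : Fin 8) → ¬ norm (+ toℕ r) (+ toℕ s) (+ toℕ t) ≡ + 5 [mod 8 ]
    table = from-yes (Fin.all? λ (r : Fin 8) → (+ 4 ∣? + toℕ r - + 2) →-dec
      (Fin.all? λ (s : Fin 8) → Fin.all? λ (t : Fin 8) → ¬? (+ 8 ∣? norm (+ toℕ r) (+ toℕ s) (+ toℕ t) - + 5)))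

  -- The missed residue depends on d: x² and x² - y² miss 2, while x² + y² (d ≡ 3) misses 3. The
  -- table finds it by search.
  norm-mod4 : ∀ d → ¬ d ≡ + 2 [mod 4 ] → MissedByNorm d 4
  norm-mod4 d d≢2 =
    let r , r≡d    = residue 4 d
        m , missed = table r (λ r≡2 → d≢2 (≡-mod-trans d (+ toℕ r) (+ 2) (≡-mod-sym (+ toℕ r) d r≡d) r≡2))
    in + toℕ m , λ x y e →
      let s , s≡x = residue 4 x
          t , t≡y = residue 4 y
      in missed s t (norm-cong d (+ toℕ r) x (+ toℕ s) y (+ toℕ t) (+ toℕ m) r≡d s≡x t≡y e)
    where
    table : ∀ (r : Fin 4) → ¬ + toℕ r ≡ + 2 [mod 4 ] →
      ∃[ m ] (∀ (s t : Fin 4) → ¬ norm (+ toℕ r) (+ toℕ s) (+ toℕ t) ≡ + toℕ {4} m [mod 4 ])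
    table = from-yes (Fin.all? λ (r : Fin 4) → ¬? (+ 4 ∣? + toℕ r - + 2) →-dec
      (Fin.any? λ (m : Fin 4) → Fin.all? λ (s : Fin 4) → Fin.all? λ (t : Fin 4) →
        ¬? (+ 4 ∣? norm (+ toℕ r) (+ toℕ s) (+ toℕ t) - + toℕ m)))

  -- Modulo 4, x² - 2y² takes the values 0, 1, 2, 3 at (0, 0), (1, 0), (0, 1), (1, 1).
  norm-universal-mod4 : ∀ d → d ≡ + 2 [mod 4 ] → ∀ l → ∃[ x ] ∃[ y ] norm d x y ≡ l [mod 4 ]
  norm-universal-mod4 d d≡2 l =
    let m , m≡l       = residue 4 l
        s , t , e     = table m
    in + toℕ s , + toℕ t , ≡-mod-trans (norm d (+ toℕ s) (+ toℕ t)) (+ toℕ m) l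
         (norm-cong (+ 2) d (+ toℕ s) (+ toℕ s) (+ toℕ t) (+ toℕ t) (+ toℕ m)
           d≡2 (≡-mod-refl (+ toℕ s)) (≡-mod-refl (+ toℕ t)) e) m≡l
    where
    table : ∀ (m : Fin 4) → ∃[ s ] ∃[ t ] norm (+ 2) (+ toℕ {4} s) (+ toℕ {4} t) ≡ + toℕ m [mod 4 ]
    table = from-yes (Fin.all? λ (m : Fin 4) → Fin.any? λ (s : Fin 4) → Fin.any? λ (t : Fin 4) →
      + 4 ∣? norm (+ 2) (+ toℕ s) (+ toℕ t) - + toℕ m)

  module _ (a B c : ℤ) where
    private
      Q = form a (B * + 2) c
      d = B * B - a * c

      scaled : ∀ x y → a * eval Q x y ≡ norm d (a * x + B * y) y
      scaled x y = lemma a B c x y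
        where
        lemma : ∀ a B c x y → a * (a * x * x + B * + 2 * x * y + c * y * y) ≡
          (a * x + B * y) * (a * x + B * y) - (B * B - a * c) * (y * y)
        lemma = solve-∀

    -- An odd a is its own inverse modulo any divisor of 8. So Q ≡ ar would give aQ ≡ r, and aQ is a
    -- value of the norm form.
    even-form-obstruction : ∀ {k} → + k ∣ + 8 → ¬ + 2 ∣ a → MissedByNorm d k → HasLocalObstruction Q k
    even-form-obstruction k∣8 2∤a (r , missed) = a * r , λ x y e → missed (a * x + B * y) y
      (∣-combine e (∣-trans k∣8 (odd⇒square≡1 a 2∤a)) a r
        (trans (cong (_- r) (sym (scaled x y))) (identity a (eval Q x y) r)))
      where
      identity : ∀ a q r → a * q - r ≡ a * (q - a * r) + r * (a * a - 1ℤ)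
      identity = solve-∀

    even-form-universal : ∀ {k} → + k ∣ + 8 → ¬ + 2 ∣ a → (∀ l → ∃[ x ] ∃[ y ] norm d x y ≡ l [mod k ]) → Universal Q k
    even-form-universal {k} k∣8 2∤a universal l =
      let x′ , y , e = universal (a * l)
          -- Solves `a * x + B * y ≡ x′`, again because a² ≡ 1.
          x          = a * (x′ - B * y)
          a²≡1       = ∣-trans k∣8 (odd⇒square≡1 a 2∤a)
          ≡x′        = ∣-*ˡ a²≡1 (x′ - B * y) (substitute a B x′ y)
          aQ≡al      = norm-cong d d x′ (a * x + B * y) y y (a * l) (≡-mod-refl d) ≡x′ (≡-mod-refl y) e
      in x , y , ∣-combine (subst (λ i → + k ∣ i - a * l) (sym (scaled x y)) aQ≡al) a²≡1 a (- (eval Q x y - l))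
           (identity a (eval Q x y) l)
      where
      substitute : ∀ a B x y → a * (a * (x - B * y)) + B * y - x ≡ (x - B * y) * (a * a - 1ℤ)
      substitute = solve-∀
      identity : ∀ a q l → q - l ≡ a * (a * q - a * l) + - (q - l) * (a * a - 1ℤ)
      identity = solve-∀

  -- b is even because b² = 4d + 4ac, so primitivity leaves a or c odd, and swapping brings the odd
  -- one to the front.
  even-form-induction : ∀ (P : BinaryQuadraticForm → Set) → (∀ Q → P (swap Q) → P Q) → ∀ d →
    (∀ a B c → ¬ + 2 ∣ a → d ≡ B * B - a * c → P (form a (B * + 2) c)) →
    ∀ Q → Primitive Q → disc Q ≡ + 4 * d → P Q
  even-form-induction P P-swap d base Q@(form a b c) prim disc≡4d = by-middle 2∣b
    where
    rearrange : ∀ a b c → b * b ≡ 1ℤ * (b * b - + 4 * a * c) + + 2 * a * c * + 2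
    rearrange = solve-∀
    factor : ∀ d → + 4 * d ≡ + 2 * d * + 2
    factor = solve-∀
    quarter : ∀ a B c → B * + 2 * (B * + 2) - + 4 * a * c ≡ + 4 * (B * B - a * c)
    quarter = solve-∀
    exchange : ∀ a B c → B * B - a * c ≡ B * B - c * a
    exchange = solve-∀
    2∣b : + 2 ∣ b
    2∣b = ∣-square prime[2] b (∣-combine (divides (+ 2 * d) (trans disc≡4d (factor d))) (∣-refl {+ 2})
      1ℤ (+ 2 * a * c) (rearrange a b c))
    by-middle : + 2 ∣ b → P Q
    by-middle 2∣b@(divides B refl) = by-parity (+ 2 ∣? a) (+ 2 ∣? c)
      where
      d≡ : d ≡ B * B - a * c
      d≡ = ℤ.*-cancelˡ-≡ (+ 4) d (B * B - a * c) (trans (sym disc≡4d) (quarter a B c))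
      by-parity : Dec (+ 2 ∣ a) → Dec (+ 2 ∣ c) → P Q
      by-parity (no 2∤a)  _         = base a B c 2∤a d≡
      by-parity (yes _)   (no 2∤c)  = P-swap Q (base c B a 2∤c (trans d≡ (exchange a B c)))
      by-parity (yes 2∣a) (yes 2∣c) = ⊥-elim (primitive-∤ a b c prim prime[2] 2∣a 2∣b 2∣c)

  obstruction-8 : ∀ Q → Primitive Q → ∀ d → disc Q ≡ + 4 * d → d ≡ + 2 [mod 4 ] → HasLocalObstruction Q 8
  obstruction-8 Q prim d eq d≡2 = even-form-induction (λ Q → HasLocalObstruction Q 8) (λ Q → obstruction-swap Q) d
    (λ a B c 2∤a d≡ → even-form-obstruction a B c (∣-refl {+ 8}) 2∤a
      (subst (λ d → MissedByNorm d 8) d≡ (norm-mod8 d d≡2)))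
    Q prim eq

  obstruction-4 : ∀ Q → Primitive Q → ∀ d → disc Q ≡ + 4 * d → ¬ d ≡ + 2 [mod 4 ] → HasLocalObstruction Q 4
  obstruction-4 Q prim d eq d≢2 = even-form-induction (λ Q → HasLocalObstruction Q 4) (λ Q → obstruction-swap Q) d
    (λ a B c 2∤a d≡ → even-form-obstruction a B c (divides (+ 2) refl) 2∤a
      (subst (λ d → MissedByNorm d 4) d≡ (norm-mod4 d d≢2)))
    Q prim eq

  universal-4 : ∀ Q → Primitive Q → ∀ d → disc Q ≡ + 4 * d → d ≡ + 2 [mod 4 ] → Universal Q 4
  universal-4 Q prim d eq d≡2 = even-form-induction (λ Q → Universal Q 4) (λ Q → universal-swap Q) d
    (λ a B c 2∤a d≡ → even-form-universal a B c (divides (+ 2) refl) 2∤a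
      (subst (λ d → ∀ l → ∃[ x ] ∃[ y ] norm d x y ≡ l [mod 4 ]) d≡ (norm-universal-mod4 d d≡2)))
    Q prim eq

  eval-1-0 : ∀ a b c → eval (form a b c) 1ℤ 0ℤ ≡ a
  eval-1-0 = identity
    where
    identity : ∀ a b c → a * 1ℤ * 1ℤ + b * 1ℤ * 0ℤ + c * 0ℤ * 0ℤ ≡ a
    identity = solve-∀

  eval-0-1 : ∀ a b c → eval (form a b c) 0ℤ 1ℤ ≡ c
  eval-0-1 a b c = trans (eval-swap (form a b c) 0ℤ 1ℤ) (eval-1-0 c b a)

  eval-1-1 : ∀ a b c → eval (form a b c) 1ℤ 1ℤ ≡ a + b + c
  eval-1-1 = identity
    where
    identity : ∀ a b c → a * 1ℤ * 1ℤ + b * 1ℤ * 1ℤ + c * 1ℤ * 1ℤ ≡ a + b + c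
    identity = solve-∀

  -- If a and c are both even, primitivity makes b odd, and then Q(1, 1) = a + b + c is odd.
  represents-odd : ∀ Q → Primitive Q → ∃[ x ] ∃[ y ] ¬ + 2 ∣ eval Q x y
  represents-odd Q@(form a b c) prim = go (+ 2 ∣? a) (+ 2 ∣? c)
    where
    go : Dec (+ 2 ∣ a) → Dec (+ 2 ∣ c) → ∃[ x ] ∃[ y ] ¬ + 2 ∣ eval Q x y
    go (no 2∤a)  _         = 1ℤ , 0ℤ , subst (λ i → ¬ + 2 ∣ i) (sym (eval-1-0 a b c)) 2∤a
    go (yes _)   (no 2∤c)  = 0ℤ , 1ℤ , subst (λ i → ¬ + 2 ∣ i) (sym (eval-0-1 a b c)) 2∤c
    go (yes 2∣a) (yes 2∣c) = 1ℤ , 1ℤ , subst (λ i → ¬ + 2 ∣ i) (sym (eval-1-1 a b c))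
      (∤-+ (λ 2∣a+b → primitive-∤ a b c prim prime[2] 2∣a (∣m+n∣m⇒∣n {m = a} 2∣a+b 2∣a) 2∣c) 2∣c)

  universal-2 : ∀ Q → Primitive Q → Universal Q 2
  universal-2 Q prim l = go (+ 2 ∣? l)
    where
    difference : ∀ q l → q - l ≡ 1ℤ * (q - 1ℤ) + -1ℤ * (l - 1ℤ)
    difference = solve-∀
    0∣ : ∀ {m} → m ∣ 0ℤ
    0∣ = divides 0ℤ refl
    go : Dec (+ 2 ∣ l) → ∃[ x ] ∃[ y ] eval Q x y ≡ l [mod 2 ]
    go (yes 2∣l) = 0ℤ , 0ℤ , ∣m∣n⇒∣m-n (eval-∣ Q {x = 0ℤ} {0ℤ} 0∣ 0∣) 2∣l
    go (no 2∤l)  = let x , y , odd = represents-odd Q prim in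
      x , y , ∣-combine (odd-1 (eval Q x y) odd) (odd-1 l 2∤l) 1ℤ -1ℤ (difference (eval Q x y) l)

  odd-disc⇒odd-middle : ∀ a b c → ¬ + 2 ∣ disc (form a b c) → ¬ + 2 ∣ b
  odd-disc⇒odd-middle a b c 2∤Δ 2∣b = 2∤Δ (∣-combine 2∣b (∣-refl {+ 2}) b (- (+ 2 * a * c)) (identity a b c))
    where
    identity : ∀ a b c → b * b - + 4 * a * c ≡ b * b + - (+ 2 * a * c) * + 2
    identity = solve-∀

  -- b is odd, so 4ac = b² - Δ is 0 modulo 8 and ac is even: one of the axis vectors is isotropic
  -- modulo 2.
  lifts-2 : ∀ Q → Primitive Q → ¬ + 2 ∣ disc Q → disc Q ≡ 1ℤ [mod 8 ] → Lifts Q 2 2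
  lifts-2 Q@(form a b c) prim 2∤Δ Δ≡1 = universal∧isotropic⇒lifts Q (universal-2 Q prim) isotropic
    where
    identity : ∀ a b c → + 4 * (a * c) ≡ 1ℤ * (b * b - 1ℤ) + -1ℤ * (b * b - + 4 * a * c - 1ℤ)
    identity = solve-∀
    2∣ac : + 2 ∣ a * c
    2∣ac = *-cancelˡ-∣ (+ 4) {+ 2} {a * c}
      (∣-combine (odd⇒square≡1 b (odd-disc⇒odd-middle a b c 2∤Δ)) Δ≡1 1ℤ -1ℤ (identity a b c))
    isotropic : Isotropic Q 2
    isotropic = go (euclid prime[2] a c 2∣ac)
      where
      go : + 2 ∣ a ⊎ + 2 ∣ c → Isotropic Q 2
      go (inj₁ 2∣a) = 1ℤ , 0ℤ , inj₁ (prime⇒∤1 prime[2]) , subst (+ 2 ∣_) (sym (eval-1-0 a b c)) 2∣a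
      go (inj₂ 2∣c) = 0ℤ , 1ℤ , inj₂ (prime⇒∤1 prime[2]) , subst (+ 2 ∣_) (sym (eval-0-1 a b c)) 2∣c

  -- Now 4ac = b² - Δ is 4 modulo 8, so a, b, c are all odd and Q is x² + xy + y² modulo 2, which is
  -- anisotropic.
  obstruction-inert-4 : ∀ Q → ¬ + 2 ∣ disc Q → disc Q ≡ + 5 [mod 8 ] → HasLocalObstruction Q 4
  obstruction-inert-4 Q@(form a b c) 2∤Δ Δ≡5 = anisotropic⇒obstruction Q prime[2] anisotropic
    where
    2∤b : ¬ + 2 ∣ b
    2∤b = odd-disc⇒odd-middle a b c 2∤Δ
    identity : ∀ a b c → + 4 * (a * c + 1ℤ) ≡ 1ℤ * (b * b - 1ℤ) + -1ℤ * (b * b - + 4 * a * c - + 5)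
    identity = solve-∀
    2∣ac+1 : + 2 ∣ a * c + 1ℤ
    2∣ac+1 = *-cancelˡ-∣ (+ 4) {+ 2} {a * c + 1ℤ} (∣-combine (odd⇒square≡1 b 2∤b) Δ≡5 1ℤ -1ℤ (identity a b c))
    2∤a : ¬ + 2 ∣ a
    2∤a 2∣a = prime⇒∤1 prime[2] (∣m+n∣m⇒∣n {m = a * c} 2∣ac+1 (∣m⇒∣m*n c 2∣a))
    2∤c : ¬ + 2 ∣ c
    2∤c 2∣c = prime⇒∤1 prime[2] (∣m+n∣m⇒∣n {m = a * c} 2∣ac+1 (∣n⇒∣m*n a 2∣c))
    reduce : ∀ x y x′ y′ → x ≡ x′ [mod 2 ] → y ≡ y′ [mod 2 ] → + 2 ∣ eval Q x y → + 2 ∣ eval Q x′ y′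
    reduce x y x′ y′ ex ey 2∣Q = ∣-combine 2∣Q (eval-cong Q x x′ y y′ ex ey) 1ℤ -1ℤ (difference (eval Q x y) (eval Q x′ y′))
      where
      difference : ∀ q r → r ≡ 1ℤ * q + -1ℤ * (q - r)
      difference = solve-∀
    even-0 : ∀ x → + 2 ∣ x → x ≡ 0ℤ [mod 2 ]
    even-0 x 2∣x = subst (+ 2 ∣_) (sym (ℤ.+-identityʳ x)) 2∣x
    sum : ∀ a b c → 1ℤ ≡ 1ℤ * (a + b + c) + -1ℤ * (a - 1ℤ + (b - 1ℤ) + (c - 1ℤ)) + -1ℤ * + 2
    sum = solve-∀
    anisotropic : ∀ x y → + 2 ∣ eval Q x y → + 2 ∣ x × + 2 ∣ y
    anisotropic x y 2∣Q = go (+ 2 ∣? x) (+ 2 ∣? y)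
      where
      go : Dec (+ 2 ∣ x) → Dec (+ 2 ∣ y) → + 2 ∣ x × + 2 ∣ y
      go (yes 2∣x) (yes 2∣y) = 2∣x , 2∣y
      go (yes 2∣x) (no 2∤y)  = contradiction
        (subst (+ 2 ∣_) (eval-0-1 a b c) (reduce x y 0ℤ 1ℤ (even-0 x 2∣x) (odd-1 y 2∤y) 2∣Q)) 2∤c
      go (no 2∤x)  (yes 2∣y) = contradiction
        (subst (+ 2 ∣_) (eval-1-0 a b c) (reduce x y 1ℤ 0ℤ (odd-1 x 2∤x) (even-0 y 2∣y) 2∣Q)) 2∤a
      go (no 2∤x)  (no 2∤y)  = ⊥-elim (prime⇒∤1 prime[2] (∣-combine₃
        (subst (+ 2 ∣_) (eval-1-1 a b c) (reduce x y 1ℤ 1ℤ (odd-1 x 2∤x) (odd-1 y 2∤y) 2∣Q))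
        (∣m∣n⇒∣m+n (∣m∣n⇒∣m+n (odd-1 a 2∤a) (odd-1 b 2∤b)) (odd-1 c 2∤c)) (∣-refl {+ 2}) 1ℤ -1ℤ -1ℤ (sum a b c)))

  -- Existence of an inert prime

  least : ∀ (P : ℕ → Set) → (∀ n → Dec (P n)) → ∀ {n} → P n → ∃[ m ] IsMin P m
  least P P? {n} = <-rec (λ n → P n → ∃[ m ] IsMin P m) go n
    where
    go : ∀ n → (∀ {j} → j ℕ.< n → P j → ∃[ m ] IsMin P m) → P n → ∃[ m ] IsMin P m
    go n rec Pn with ℕ.anyUpTo? P? n
    ... | yes (j , j<n , Pj) = rec j<n Pj
    ... | no none            = n , Pn , λ k Pk → ℕ.≮⇒≥ λ k<n → none (k , k<n , Pk)

  product≡3-mod-4 : ∀ m n → (m ℕ.* n) % 4 ≡ 3 → m % 4 ≡ 3 ⊎ n % 4 ≡ 3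
  product≡3-mod-4 m n eq = subst₂ (λ r s → r ≡ 3 ⊎ s ≡ 3) (Fin.toℕ-fromℕ< (m%n<n m 4)) (Fin.toℕ-fromℕ< (m%n<n n 4))
    (table (fromℕ< (m%n<n m 4)) (fromℕ< (m%n<n n 4))
      (trans (cong₂ (λ r s → (r ℕ.* s) % 4) (Fin.toℕ-fromℕ< (m%n<n m 4)) (Fin.toℕ-fromℕ< (m%n<n n 4)))
        (trans (sym (%-distribˡ-* m n 4)) eq)))
    where
    table : ∀ (r s : Fin 4) → (toℕ r ℕ.* toℕ s) % 4 ≡ 3 → toℕ r ≡ 3 ⊎ toℕ s ≡ 3
    table = from-yes (Fin.all? λ (r : Fin 4) → Fin.all? λ (s : Fin 4) →
      ((toℕ r ℕ.* toℕ s) % 4 ℕ.≟ 3) →-dec ((toℕ r ℕ.≟ 3) ⊎-dec (toℕ s ℕ.≟ 3)))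

  cofactor≡3-mod-4 : ∀ m n → n % 4 ≡ 3 → (m ℕ.* n) % 4 ≡ 1 → m % 4 ≡ 3
  cofactor≡3-mod-4 m n n≡3 eq = subst (_≡ 3) (Fin.toℕ-fromℕ< (m%n<n m 4))
    (table (fromℕ< (m%n<n m 4))
      (trans (cong₂ (λ r s → (r ℕ.* s) % 4) (Fin.toℕ-fromℕ< (m%n<n m 4)) (sym n≡3))
        (trans (sym (%-distribˡ-* m n 4)) eq)))
    where
    table : ∀ (r : Fin 4) → (toℕ r ℕ.* 3) % 4 ≡ 1 → toℕ r ≡ 3
    table = from-yes (Fin.all? λ (r : Fin 4) → ((toℕ r ℕ.* 3) % 4 ℕ.≟ 1) →-dec (toℕ r ℕ.≟ 3))

  ≡3-mod-4⇒odd : ∀ n → n % 4 ≡ 3 → Odd n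
  ≡3-mod-4⇒odd n n≡3 2∣n = from-no (2 ℕ.∣? 3) (subst (2 ℕ.∣_) n≡3 (ℕ.%-presˡ-∣ 2∣n (ℕ.divides 2 refl)))

  -- When a product is 3 modulo 4, so is one of its factors: either the prime split off serves, or
  -- the search continues in the cofactor.
  prime-divisor≡3-mod-4 : ∀ n → n % 4 ≡ 3 → ∃[ q ] Prime q × q ℕ.∣ n × q % 4 ≡ 3
  prime-divisor≡3-mod-4 = <-rec _ go
    where
    go : ∀ n → (∀ {j} → j ℕ.< n → j % 4 ≡ 3 → ∃[ q ] Prime q × q ℕ.∣ j × q % 4 ≡ 3) →
         n % 4 ≡ 3 → ∃[ q ] Prime q × q ℕ.∣ n × q % 4 ≡ 3
    go 0 _ ()
    go 1 _ ()
    go n@(suc (suc _)) rec n≡3 with prime-divisor n (ℕ.s≤s (ℕ.s≤s ℕ.z≤n))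
    ... | p , pp , ℕ.divides (suc m) eq with product≡3-mod-4 (suc m) p (trans (cong (_% 4) (sym eq)) n≡3)
    ...   | inj₂ p≡3 = p , pp , ℕ.divides (suc m) eq , p≡3
    ...   | inj₁ m≡3 with rec (subst (suc m ℕ.<_) (sym eq) (ℕ.m<m*n (suc m) p (prime⇒2≤ pp))) m≡3
    ...     | q , qq , q∣m , q≡3 = q , qq , subst (q ℕ.∣_) (sym eq) (ℕ.∣m⇒∣m*n p q∣m) , q≡3

  odd+odd : ∀ k l → 2 ℕ.∣ suc (k ℕ.+ k) ℕ.+ suc (l ℕ.+ l)
  odd+odd k l = ℕ.divides (suc (k ℕ.+ l)) (identity k l)
    where
    identity : ∀ k l → suc (k ℕ.+ k) ℕ.+ suc (l ℕ.+ l) ≡ suc (k ℕ.+ l) ℕ.* 2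
    identity = ℕ-solve

  -- As n is odd, r or n - r is even, and both square to -1 modulo n. An even y makes y² + 1 ≡ 1
  -- (mod 4), from which the descent reads off that the cofactor is 3 modulo 4.
  even-representative : ∀ n → Odd n → ∀ r → r ℕ.< n → + n ∣ + r * + r + 1ℤ →
    ∃[ k ] k ℕ.+ k ℕ.< n × + n ∣ + (k ℕ.+ k) * + (k ℕ.+ k) + 1ℤ
  even-representative n odd r r<n n∣r²+1 = go (even⊎odd r) (even⊎odd (n ℕ.∸ r))
    where
    r+s≡n : r ℕ.+ (n ℕ.∸ r) ≡ n
    r+s≡n = ℕ.m+[n∸m]≡n (ℕ.<⇒≤ r<n)
    identity : ∀ r s → s * s + 1ℤ ≡ (s - r) * (r + s) + 1ℤ * (r * r + 1ℤ)
    identity = solve-∀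
    complement : + n ∣ + (n ℕ.∸ r) * + (n ℕ.∸ r) + 1ℤ
    complement = ∣-combine (subst (λ i → + n ∣ + i) (sym r+s≡n) (∣-refl {+ n})) n∣r²+1
      (+ (n ℕ.∸ r) - + r) 1ℤ (identity (+ r) (+ (n ℕ.∸ r)))
    Representative : ℕ → Set
    Representative s = s ℕ.< n × + n ∣ + s * + s + 1ℤ
    go : ∃[ k ] (r ≡ k ℕ.+ k ⊎ r ≡ suc (k ℕ.+ k)) → ∃[ l ] (n ℕ.∸ r ≡ l ℕ.+ l ⊎ n ℕ.∸ r ≡ suc (l ℕ.+ l)) →
      ∃[ k ] Representative (k ℕ.+ k)
    go (k , inj₁ eq) _ = k , subst Representative eq (r<n , n∣r²+1)
    go (k , inj₂ eq) (l , inj₁ eq′) = l , subst Representative eq′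
      (ℕ.∸-monoʳ-< (subst (0 ℕ.<_) (sym eq) (ℕ.s≤s ℕ.z≤n)) (ℕ.<⇒≤ r<n) , complement)
    go (k , inj₂ eq) (l , inj₂ eq′) =
      contradiction (subst (2 ℕ.∣_) (trans (sym (cong₂ ℕ._+_ eq eq′)) r+s≡n) (odd+odd k l)) odd

  -- Descent on n: an even x < n gives x² + 1 = m n with m < n and again m ≡ 3 (mod 4).
  ≡3-mod-4⇒∤x²+1 : ∀ n → n % 4 ≡ 3 → ∀ x → ¬ + n ∣ x * x + 1ℤ
  ≡3-mod-4⇒∤x²+1 = <-rec _ go
    where
    go : ∀ n → (∀ {j} → j ℕ.< n → j % 4 ≡ 3 → ∀ x → ¬ + j ∣ x * x + 1ℤ) → n % 4 ≡ 3 → ∀ x → ¬ + n ∣ x * x + 1ℤ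
    go 0 _ ()
    go 1 _ ()
    go n@(suc n′@(suc _)) rec n≡3 x n∣x²+1 = descend n∣y²+1
      where
      r = toℕ (proj₁ (residue n x))
      identity : ∀ r x → r * r + 1ℤ ≡ 1ℤ * (x * x + 1ℤ) + (r + x) * (r - x)
      identity = solve-∀
      even = even-representative n (≡3-mod-4⇒odd n n≡3) r (Fin.toℕ<n (proj₁ (residue n x)))
        (∣-combine n∣x²+1 (proj₂ (residue n x)) 1ℤ (+ r + x) (identity (+ r) x))
      k = proj₁ even
      y = k ℕ.+ k
      y<n : y ℕ.< n
      y<n = proj₁ (proj₂ even)
      y²+1≡ : + y * + y + 1ℤ ≡ + (1 ℕ.+ y ℕ.* y)
      y²+1≡ = trans (ℤ.+-comm (+ y * + y) 1ℤ) (cong (λ i → 1ℤ + i) (sym (ℤ.pos-* y y)))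
      n∣y²+1 : n ℕ.∣ 1 ℕ.+ y ℕ.* y
      n∣y²+1 = +∣+⇒∣ (subst (+ n ∣_) y²+1≡ (proj₂ (proj₂ even)))
      y²+1<n² : 1 ℕ.+ y ℕ.* y ℕ.< n ℕ.* n
      -- Here n * n is n + n′ * n, with 2 ≤ n and y * y ≤ n′ * n.
      y²+1<n² = ℕ.s≤s (ℕ.+-mono-≤ (ℕ.s≤s (ℕ.z≤n {_}))
        (ℕ.*-mono-≤ (ℕ.s≤s⁻¹ y<n) (ℕ.<⇒≤ y<n)))
      expand : ∀ k → 1 ℕ.+ (k ℕ.+ k) ℕ.* (k ℕ.+ k) ≡ 1 ℕ.+ (k ℕ.* k) ℕ.* 4
      expand = ℕ-solve
      descend : n ℕ.∣ 1 ℕ.+ y ℕ.* y → ⊥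
      descend (ℕ.divides m eq) = rec m<n (cofactor≡3-mod-4 m n n≡3 mn≡1) (+ y)
          (subst (+ m ∣_) (sym y²+1≡) (∣⇒+∣+ (subst (m ℕ.∣_) (sym eq) (ℕ.m∣m*n n))))
        where
        mn≡1 : (m ℕ.* n) % 4 ≡ 1
        mn≡1 = trans (cong (_% 4) (trans (sym eq) (expand k))) ([m+kn]%n≡m%n 1 (k ℕ.* k) 4)
        m<n : m ℕ.< n
        m<n = ℕ.*-cancelʳ-< n m n (subst (ℕ._< n ℕ.* n) eq y²+1<n²)

  -- Modulo 4|Δ| - 1 we have 4Δ ≡ - 1, so Δ is a nonresidue modulo any prime divisor ≡ 3 (mod 4) of 4|Δ| - 1.
  negative⇒nonresidue-prime : ∀ n → ∃[ q ] OddPrime q × legendre (- + suc n) q ≡ -1ℤ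
  negative⇒nonresidue-prime n =
    let q , qq , q∣N , q≡3 = prime-divisor≡3-mod-4 N ([m+kn]%n≡m%n 3 n 4)
        q∣4Δ+1 = subst (+ q ∣_) N≡ (∣⇒+∣+ q∣N)
    in q , (qq , ≡3-mod-4⇒odd q q≡3) , nonresidue⇒legendre≡-1 Δ q
      (λ q∣Δ → prime⇒∤1 qq (∣-combine q∣4Δ+1 q∣Δ -1ℤ (- + 4) (unit Δ)))
      -- X² ≡ Δ would give (2X)² ≡ 4Δ ≡ -1 modulo q.
      (λ X e → ≡3-mod-4⇒∤x²+1 q q≡3 (+ 2 * X) (∣-combine e q∣4Δ+1 (+ 4) -1ℤ (double X Δ)))
    where
    Δ = - + suc n
    -- This is 4|Δ| - 1, in a shape that displays its residue modulo 4.
    N = 3 ℕ.+ n ℕ.* 4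
    shift : ∀ n → + 3 + n * + 4 ≡ - (+ 4 * (- (1ℤ + n))) - 1ℤ
    shift = solve-∀
    N≡ : + N ≡ - (+ 4 * Δ) - 1ℤ
    N≡ = trans (cong (λ i → + 3 + i) (ℤ.pos-* n 4)) (shift (+ n))
    unit : ∀ Δ → 1ℤ ≡ -1ℤ * (- (+ 4 * Δ) - 1ℤ) + - + 4 * Δ
    unit = solve-∀
    double : ∀ X Δ → + 2 * X * (+ 2 * X) + 1ℤ ≡ + 4 * (X * X - Δ) + -1ℤ * (- (+ 4 * Δ) - 1ℤ)
    double = solve-∀

  -- Q(1, 0) = a and Q(-b, 2a) = -aΔ are both positive; (-b, 2a) is a vector at which 2ax + by
  -- vanishes.
  positiveDefinite⇒disc<0 : ∀ Q → PositiveDefinite Q → ∃[ n ] disc Q ≡ - + suc n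
  positiveDefinite⇒disc<0 Q@(form a b c) pos = from-positive (- disc Q) refl -Δ>0
    where
    a>0 : 0ℤ < a
    a>0 = subst (0ℤ <_) (eval-1-0 a b c) (pos 1ℤ 0ℤ λ ())
    vertex : ∀ a b c → a * (- b) * (- b) + b * (- b) * (+ 2 * a) + c * (+ 2 * a) * (+ 2 * a) ≡ a * (- (b * b - + 4 * a * c))
    vertex = solve-∀
    a≢0 : a ≢ 0ℤ
    a≢0 a≡0 = ℤ.<-irrefl refl (subst (0ℤ <_) a≡0 a>0)
    a*-Δ>0 : a * 0ℤ < a * (- disc Q)
    a*-Δ>0 = subst₂ _<_ (sym (ℤ.*-zeroʳ a)) (vertex a b c)
      (pos (- b) (+ 2 * a) λ (_ , 2a≡0) → a≢0 (ℤ.*-cancelˡ-≡ (+ 2) a 0ℤ 2a≡0))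
    -Δ>0 : 0ℤ < - disc Q
    -Δ>0 = ℤ.*-cancelˡ-<-nonNeg a {{ℤ.nonNegative (ℤ.<⇒≤ a>0)}} a*-Δ>0
    from-positive : ∀ i → i ≡ - disc Q → 0ℤ < i → ∃[ n ] disc Q ≡ - + suc n
    from-positive (+ suc n) eq _ = n , trans (sym (ℤ.neg-involutive (disc Q))) (cong -_ (sym eq))
    from-positive (+ 0) _ (ℤ.+<+ ())

  -- The minimal obstruction modulus

  prime≡2⊎odd : ∀ {p} → Prime p → p ≡ 2 ⊎ Odd p
  prime≡2⊎odd {p} pp with 2 ℕ.∣? p
  ... | no 2∤p = inj₂ 2∤p
  ... | yes 2∣p with prime⇒irreducible pp 2∣p
  ...   | inj₂ 2≡p = inj₁ (sym 2≡p)

  oddPrime⇒3≤ : ∀ {p} → OddPrime p → 3 ℕ.≤ p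
  oddPrime⇒3≤ (pp , odd) = ℕ.≤∧≢⇒< (prime⇒2≤ pp) λ { refl → odd ℕ.∣-refl }

  minimal : ∀ Q κ → 1 ℕ.≤ κ → HasLocalObstruction Q κ → (∀ k → 1 ℕ.≤ k → k ℕ.< κ → Universal Q k) →
    IsMinimalObstructionModulus Q [ κ ]
  minimal Q κ 1≤κ obstruction universal = (1≤κ , obstruction) ,
    λ k (1≤k , obs) → ℕ.≮⇒≥ λ k<κ → universal⇒¬obstruction Q (universal k 1≤k k<κ) obs

  -- All prime powers dividing k < κ lie below κ. A first power of an odd prime is settled by p ∤ Δ;
  -- a higher one forces p² < κ, which is where Δ must be a square modulo p so that Hensel lifting
  -- applies.
  universal-below : ∀ Q κ →
    (∀ e → 1 ℕ.≤ e → 2 ℕ.^ e ℕ.< κ → Universal Q (2 ℕ.^ e)) →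
    (∀ p → OddPrime p → p ℕ.< κ → ¬ + p ∣ disc Q) →
    (∀ p → OddPrime p → p ℕ.^ 2 ℕ.< κ → legendre (disc Q) p ≢ -1ℤ) →
    ∀ k → 1 ℕ.≤ k → k ℕ.< κ → Universal Q k
  universal-below Q κ at-2 unramified split k 1≤k k<κ =
    prime-power-induction (Universal Q) (universal-1 Q) (universal-* Q) k 1≤k at-prime-power
    where
    ∣k⇒<κ : ∀ {n} → n ℕ.∣ k → n ℕ.< κ
    ∣k⇒<κ n∣k = ℕ.≤-<-trans (ℕ.∣⇒≤ {{ℕ.>-nonZero 1≤k}} n∣k) k<κ
    odd-prime-power : ∀ p e → OddPrime p → 1 ℕ.≤ e → p ℕ.^ e ℕ.< κ → Universal Q (p ℕ.^ e)
    odd-prime-power p 1 op _ p^1<κ = subst (Universal Q) p≡p^1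
      (universal-odd-prime Q op (unramified p op (subst (ℕ._< κ) (sym p≡p^1) p^1<κ)))
      where
      p≡p^1 : p ≡ p ℕ.^ 1
      p≡p^1 = sym (ℕ.*-identityʳ p)
    odd-prime-power p e@(suc (suc f)) op@(pp , _) 1≤e p^e<κ =
      let s , s²≡Δ = legendre≢-1⇒square (disc Q) p p∤Δ (split p op p²<κ)
      in hensel Q pp p∤Δ
           (universal∧isotropic⇒lifts Q (universal-odd-prime Q op p∤Δ) (square-disc⇒isotropic Q op s s²≡Δ)) e 1≤e
      where
      p^-mono : ∀ {i j} → i ℕ.≤ j → p ℕ.^ i ℕ.≤ p ℕ.^ j
      p^-mono = ℕ.^-monoʳ-≤ p {{prime⇒nonZero pp}}
      p²<κ : p ℕ.^ 2 ℕ.< κ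
      p²<κ = ℕ.≤-<-trans (p^-mono (ℕ.s≤s (ℕ.s≤s (ℕ.z≤n {f})))) p^e<κ
      p<κ : p ℕ.< κ
      p<κ = ℕ.≤-<-trans (subst (ℕ._≤ p ℕ.^ 2) (ℕ.*-identityʳ p) (p^-mono {1} {2} (ℕ.s≤s ℕ.z≤n))) p²<κ
      p∤Δ : ¬ + p ∣ disc Q
      p∤Δ = unramified p op p<κ
    at-prime-power : ∀ p e → Prime p → 1 ℕ.≤ e → p ℕ.^ e ℕ.∣ k → Universal Q (p ℕ.^ e)
    at-prime-power p e pp 1≤e p^e∣k = go (prime≡2⊎odd pp)
      where
      go : p ≡ 2 ⊎ Odd p → Universal Q (p ℕ.^ e)
      go (inj₁ p≡2) = subst (λ p → Universal Q (p ℕ.^ e)) (sym p≡2)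
        (at-2 e 1≤e (∣k⇒<κ (subst (λ p → p ℕ.^ e ℕ.∣ k) p≡2 p^e∣k)))
      go (inj₂ odd) = odd-prime-power p e (pp , odd) 1≤e (∣k⇒<κ p^e∣k)

  -- The least square of an odd prime is 9, so for κ ≤ 8 the condition at inert primes is vacuous.
  small-square : ∀ {p κ} → OddPrime p → κ ℕ.≤ 8 → ¬ p ℕ.^ 2 ℕ.< κ
  small-square {p} op κ≤8 p²<κ =
    ℕ.<⇒≱ (ℕ.≤-<-trans (ℕ.^-monoˡ-≤ 2 (oddPrime⇒3≤ op)) (ℕ.<-≤-trans p²<κ κ≤8)) (from-yes (8 ℕ.≤? 9))

  universal-below-4 : ∀ Q κ → κ ℕ.≤ 4 → Primitive Q → (∀ p → OddPrime p → p ℕ.< κ → ¬ + p ∣ disc Q) →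
    ∀ k → 1 ℕ.≤ k → k ℕ.< κ → Universal Q k
  universal-below-4 Q κ κ≤4 prim unramified = universal-below Q κ at-2 unramified
    λ p op p²<κ → contradiction p²<κ (small-square op (ℕ.≤-trans κ≤4 (from-yes (4 ℕ.≤? 8))))
    where
    at-2 : ∀ e → 1 ℕ.≤ e → 2 ℕ.^ e ℕ.< κ → Universal Q (2 ℕ.^ e)
    at-2 1 _ _ = universal-2 Q prim
    at-2 (suc (suc e)) _ 2^e<κ = contradiction (ℕ.^-monoʳ-≤ 2 {2} {suc (suc e)} (ℕ.s≤s (ℕ.s≤s ℕ.z≤n)))
      (ℕ.<⇒≱ (ℕ.<-≤-trans 2^e<κ κ≤4))

  universal-below-8 : ∀ Q κ → κ ℕ.≤ 8 → Primitive Q → Universal Q 4 → (∀ p → OddPrime p → p ℕ.< κ → ¬ + p ∣ disc Q) →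
    ∀ k → 1 ℕ.≤ k → k ℕ.< κ → Universal Q k
  universal-below-8 Q κ κ≤8 prim u4 unramified = universal-below Q κ at-2 unramified
    λ p op p²<κ → contradiction p²<κ (small-square op κ≤8)
    where
    at-2 : ∀ e → 1 ℕ.≤ e → 2 ℕ.^ e ℕ.< κ → Universal Q (2 ℕ.^ e)
    at-2 1 _ _ = universal-2 Q prim
    at-2 2 _ _ = u4
    at-2 (suc (suc (suc e))) _ 2^e<κ = contradiction (ℕ.^-monoʳ-≤ 2 {3} {suc (suc (suc e))} (ℕ.s≤s (ℕ.s≤s (ℕ.s≤s ℕ.z≤n))))
      (ℕ.<⇒≱ (ℕ.<-≤-trans 2^e<κ κ≤8))

  leastOddPrimeDivisor : ∀ Δ {p} → OddPrime p → + p ∣ Δ → ∃[ pmin ] IsLeastOddPrimeDivisor Δ pmin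
  leastOddPrimeDivisor Δ op p∣Δ = least (λ p → OddPrime p × + p ∣ Δ)
    (λ p → (prime? p ×-dec ¬? (2 ℕ.∣? p)) ×-dec (+ p ∣? Δ)) (op , p∣Δ)

  leastOddNonresiduePrime : ∀ Δ {q} → OddPrime q → legendre Δ q ≡ -1ℤ → ∃[ qmin ] IsLeastOddNonresiduePrime Δ qmin
  leastOddNonresiduePrime Δ op eq = least (λ q → OddPrime q × legendre Δ q ≡ -1ℤ)
    (λ q → (prime? q ×-dec ¬? (2 ℕ.∣? q)) ×-dec (legendre Δ q ℤ.≟ -1ℤ)) (op , eq)

  odd-prime-divisor : ∀ n → 2 ℕ.≤ n → Odd n → ∃[ p ] OddPrime p × p ℕ.∣ n
  odd-prime-divisor n 2≤n odd = let p , pp , p∣n = prime-divisor n 2≤n in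
    p , (pp , λ 2∣p → odd (ℕ.∣-trans 2∣p p∣n)) , p∣n

  -- Gives an obstruction at a minimum from obstructions at both candidates, whichever is smaller.
  ⊓-intro : ∀ (P : ℕ → Set) m n → P m → P n → P (m ℕ.⊓ n)
  ⊓-intro P m n Pm Pn with ℕ.⊓-sel m n
  ... | inj₁ eq = subst P (sym eq) Pm
  ... | inj₂ eq = subst P (sym eq) Pn

  -- M κ stands for the assertion that κ is the minimal obstruction modulus.
  PartI PartII : ℤ → (ℕ → Set) → Set
  PartI Δ M =
    ∃[ n ] ∃[ m ]
      (2 ℕ.≤ n × 1 ℕ.≤ m × Odd m × Δ ≡ - (+ (2 ℕ.^ n ℕ.* m)))
      × (m ≡ 1 → n ≡ 3 → M 8)
      × (m ≡ 1 → n ≢ 3 → M 4)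
      × (m ≢ 1 → ∃[ pmin ] IsLeastOddPrimeDivisor Δ pmin × (n ≡ 3 → M (8 ℕ.⊓ pmin)) × (n ≢ 3 → M (4 ℕ.⊓ pmin)))
  PartII Δ M =
    ∃[ pmin ] ∃[ qmin ]
      IsLeastOddPrimeDivisor Δ pmin
      × IsLeastOddNonresiduePrime Δ qmin
      × (+ 3 ∣ Δ → M 3)
      × (¬ (+ 3 ∣ Δ) → Δ ≡ + 5 [mod 8 ] → M 4)
      × (¬ (+ 3 ∣ Δ) → Δ ≡ + 1 [mod 8 ] → M (pmin ℕ.⊓ qmin ℕ.^ 2))

  partI-map : ∀ {Δ M N} → (∀ κ → M κ → N κ) → PartI Δ M → PartI Δ N
  partI-map f (n , m , conds , m1n3 , m1n≢3 , m≢1) =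
    n , m , conds , (λ h h′ → f _ (m1n3 h h′)) , (λ h h′ → f _ (m1n≢3 h h′)) ,
    λ h → let pmin , isMin , n3 , n≢3 = m≢1 h in pmin , isMin , (λ h → f _ (n3 h)) , (λ h → f _ (n≢3 h))

  partII-map : ∀ {Δ M N} → (∀ κ → M κ → N κ) → PartII Δ M → PartII Δ N
  partII-map f (pmin , qmin , isP , isQ , by-3 , by-5 , by-1) =
    pmin , qmin , isP , isQ , (λ h → f _ (by-3 h)) , (λ h h′ → f _ (by-5 h h′)) , (λ h h′ → f _ (by-1 h h′))

  -- The cases are exhaustive, so the formula always yields a finite modulus; taken at
  -- `MinimalModulus`, it is common to all primitive forms of discriminant Δ.
  partI-value : ∀ {Δ M} → PartI Δ M → ∃[ κ ] M κ
  partI-value (n , m , _ , m1n3 , m1n≢3 , m≢1) with m ℕ.≟ 1 | n ℕ.≟ 3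
  ... | yes m≡1 | yes n≡3 = _ , m1n3 m≡1 n≡3
  ... | yes m≡1 | no n≢3  = _ , m1n≢3 m≡1 n≢3
  ... | no h    | yes n≡3 = let _ , _ , n3 , _ = m≢1 h in _ , n3 n≡3
  ... | no h    | no n≢3  = let _ , _ , _ , f = m≢1 h in _ , f n≢3

  1-or-5-mod-8 : ∀ {Δ} → Δ ≡ 1ℤ [mod 4 ] → Δ ≡ 1ℤ [mod 8 ] ⊎ Δ ≡ + 5 [mod 8 ]
  1-or-5-mod-8 {Δ} Δ≡1@(divides q eq) = go (+ 2 ∣? q)
    where
    lift : + 2 ∣ q → Δ ≡ 1ℤ [mod 8 ]
    lift (divides r refl) = divides r (trans eq (ℤ.*-assoc r (+ 2) (+ 4)))
    shift : ∀ Δ → Δ - + 5 ≡ Δ - 1ℤ - + 4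
    shift = solve-∀
    factor : ∀ q → q * + 4 - + 4 ≡ (q - 1ℤ) * + 4
    factor = solve-∀
    lift′ : + 2 ∣ q - 1ℤ → Δ ≡ + 5 [mod 8 ]
    lift′ (divides r eq′) = divides r (trans (shift Δ) (trans (cong (_- + 4) eq) (trans (factor q)
      (trans (cong (_* + 4) eq′) (ℤ.*-assoc r (+ 2) (+ 4))))))
    go : Dec (+ 2 ∣ q) → Δ ≡ 1ℤ [mod 8 ] ⊎ Δ ≡ + 5 [mod 8 ]
    go (yes 2∣q) = inj₁ (lift 2∣q)
    go (no 2∤q)  = inj₂ (lift′ (odd-1 q 2∤q))

  partII-value : ∀ {Δ M} → Δ ≡ 1ℤ [mod 4 ] → PartII Δ M → ∃[ κ ] M κ
  partII-value {Δ} {M} Δ≡1 (_ , _ , _ , _ , by-3 , by-5 , by-1) = go (+ 3 ∣? Δ) (1-or-5-mod-8 {Δ} Δ≡1)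
    where
    go : Dec (+ 3 ∣ Δ) → Δ ≡ 1ℤ [mod 8 ] ⊎ Δ ≡ + 5 [mod 8 ] → ∃[ κ ] M κ
    go (yes 3∣Δ) _        = _ , by-3 3∣Δ
    go (no 3∤Δ)  (inj₁ h) = _ , by-1 3∤Δ h
    go (no 3∤Δ)  (inj₂ h) = _ , by-5 3∤Δ h

  -- The quantifier over forms sits inside, after κ: a single witness then serves both the formula
  -- and the dependence on Δ alone.
  MinimalModulus : ℤ → ℕ → Set
  MinimalModulus Δ κ = ∀ Q → Primitive Q → disc Q ≡ Δ → IsMinimalObstructionModulus Q [ κ ]

  odd-disc : ∀ {Δ} → Δ ≡ 1ℤ [mod 4 ] → ¬ + 2 ∣ Δ
  odd-disc {Δ} Δ≡1 2∣Δ = prime⇒∤1 prime[2] (∣-combine 2∣Δ (∣-trans (divides (+ 2) refl) Δ≡1) 1ℤ -1ℤ (identity Δ))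
    where
    identity : ∀ Δ → 1ℤ ≡ 1ℤ * Δ + -1ℤ * (Δ - 1ℤ)
    identity = solve-∀

  ∣-neg : ∀ {k n} → k ℕ.∣ n → + k ∣ - + n
  ∣-neg h = ∣m⇒∣-m (∣⇒+∣+ h)

  ∣-neg⁻ : ∀ {k n} → + k ∣ - + n → k ℕ.∣ n
  ∣-neg⁻ {k} {n} h = +∣+⇒∣ (subst (+ k ∣_) (ℤ.neg-involutive (+ n)) (∣m⇒∣-m h))

  oddPrime[3] : OddPrime 3
  oddPrime[3] = from-yes (prime? 3) , from-no (2 ℕ.∣? 3)

  oddPrime⇒1≤ : ∀ {p} → OddPrime p → 1 ℕ.≤ p
  oddPrime⇒1≤ op = ℕ.≤-trans (from-yes (1 ℕ.≤? 3)) (oddPrime⇒3≤ op)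

  -- The minimal modulus of a single form, case by case

  module _ (Q : BinaryQuadraticForm) (prim : Primitive Q) where

    unramified-below : ∀ {κ pmin} → IsLeastOddPrimeDivisor (disc Q) pmin → κ ℕ.≤ pmin →
      ∀ p → OddPrime p → p ℕ.< κ → ¬ + p ∣ disc Q
    unramified-below (_ , pmin≤) κ≤pmin p op p<κ p∣Δ = ℕ.<⇒≱ (ℕ.<-≤-trans p<κ κ≤pmin) (pmin≤ p (op , p∣Δ))

    minimal-3 : + 3 ∣ disc Q → IsMinimalObstructionModulus Q [ 3 ]
    minimal-3 3∣Δ = minimal Q 3 (ℕ.s≤s ℕ.z≤n) (obstruction-ramified Q prim oddPrime[3] 3∣Δ)
      (universal-below-4 Q 3 (from-yes (3 ℕ.≤? 4)) prim λ p op p<3 → contradiction (oddPrime⇒3≤ op) (ℕ.<⇒≱ p<3))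

    minimal-inert-4 : ¬ + 2 ∣ disc Q → ¬ + 3 ∣ disc Q → disc Q ≡ + 5 [mod 8 ] → IsMinimalObstructionModulus Q [ 4 ]
    minimal-inert-4 2∤Δ 3∤Δ Δ≡5 = minimal Q 4 (ℕ.s≤s ℕ.z≤n) (obstruction-inert-4 Q 2∤Δ Δ≡5)
      (universal-below-4 Q 4 ℕ.≤-refl prim λ p op p<4 p∣Δ →
        3∤Δ (subst (λ p → + p ∣ disc Q) (ℕ.≤-antisym (ℕ.s≤s⁻¹ p<4) (oddPrime⇒3≤ op)) p∣Δ))

    minimal-split : ¬ + 2 ∣ disc Q → disc Q ≡ 1ℤ [mod 8 ] → ∀ {pmin qmin} →
      IsLeastOddPrimeDivisor (disc Q) pmin → IsLeastOddNonresiduePrime (disc Q) qmin →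
      IsMinimalObstructionModulus Q [ pmin ℕ.⊓ qmin ℕ.^ 2 ]
    minimal-split 2∤Δ Δ≡1 {pmin} {qmin} isP@((opmin , pmin∣Δ) , _) ((oqmin , leg) , qmin≤) =
      minimal Q (pmin ℕ.⊓ qmin ℕ.^ 2)
        (⊓-intro (1 ℕ.≤_) pmin (qmin ℕ.^ 2) (oddPrime⇒1≤ opmin) (ℕ.^-monoˡ-≤ 2 (oddPrime⇒1≤ oqmin)))
        (⊓-intro (HasLocalObstruction Q) pmin (qmin ℕ.^ 2) (obstruction-ramified Q prim opmin pmin∣Δ)
          (anisotropic⇒obstruction Q (proj₁ oqmin) (inert⇒anisotropic Q oqmin
            (proj₂ (legendre≡-1⇒nonresidue (disc Q) qmin {{prime⇒nonZero (proj₁ oqmin)}} leg)))))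
        (universal-below Q (pmin ℕ.⊓ qmin ℕ.^ 2)
          -- With Δ odd the Hessian is invertible modulo 2, so Hensel lifting handles all powers of
          -- 2 just as for odd primes.
          (λ e 1≤e _ → hensel Q prime[2] 2∤Δ (lifts-2 Q prim 2∤Δ Δ≡1) e 1≤e)
          (unramified-below isP (ℕ.m⊓n≤m pmin (qmin ℕ.^ 2)))
          (λ p op p²< leg → ℕ.<⇒≱ (ℕ.<-≤-trans p²< (ℕ.m⊓n≤n pmin (qmin ℕ.^ 2))) (ℕ.^-monoˡ-≤ 2 (qmin≤ p (op , leg)))))

    minimal-even-4 : ∀ κ → 1 ℕ.≤ κ → κ ℕ.≤ 4 → HasLocalObstruction Q κ →
      (∀ p → OddPrime p → p ℕ.< κ → ¬ + p ∣ disc Q) → IsMinimalObstructionModulus Q [ κ ]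
    minimal-even-4 κ 1≤κ κ≤4 obstruction unramified =
      minimal Q κ 1≤κ obstruction (universal-below-4 Q κ κ≤4 prim unramified)

    minimal-even-8 : ∀ d → disc Q ≡ + 4 * d → d ≡ + 2 [mod 4 ] → ∀ κ → 1 ℕ.≤ κ → κ ℕ.≤ 8 → HasLocalObstruction Q κ →
      (∀ p → OddPrime p → p ℕ.< κ → ¬ + p ∣ disc Q) → IsMinimalObstructionModulus Q [ κ ]
    minimal-even-8 d eq d≡2 κ 1≤κ κ≤8 obstruction unramified =
      minimal Q κ 1≤κ obstruction (universal-below-8 Q κ κ≤8 prim (universal-4 Q prim d eq d≡2) unramified)

  -- Discriminants congruent to 1 modulo 4

  part-II : ∀ n Δ → Δ ≡ - + suc n → Δ ≡ 1ℤ [mod 4 ] → PartII Δ (MinimalModulus Δ)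
  part-II n Δ Δ≡-D Δ≡1 =
    let p , op , p∣D  = odd-prime-divisor (suc n) (2≤D n (subst (_≡ 1ℤ [mod 4 ]) Δ≡-D Δ≡1))
                          (λ 2∣D → 2∤Δ (subst (+ 2 ∣_) (sym Δ≡-D) (∣-neg 2∣D)))
        pmin , isP    = leastOddPrimeDivisor Δ op (subst (+ p ∣_) (sym Δ≡-D) (∣-neg p∣D))
        q , oq , leg  = negative⇒nonresidue-prime n
        qmin , isQ    = leastOddNonresiduePrime Δ oq (subst (λ Δ → legendre Δ q ≡ -1ℤ) (sym Δ≡-D) leg)
    in pmin , qmin , isP , isQ ,
       (λ 3∣Δ Q prim eq → minimal-3 Q prim (subst (+ 3 ∣_) (sym eq) 3∣Δ)) ,
       (λ 3∤Δ Δ≡5 Q prim eq → minimal-inert-4 Q prim (subst (λ Δ → ¬ + 2 ∣ Δ) (sym eq) 2∤Δ)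
         (subst (λ Δ → ¬ + 3 ∣ Δ) (sym eq) 3∤Δ) (subst (_≡ + 5 [mod 8 ]) (sym eq) Δ≡5)) ,
       (λ _ Δ≡1 Q prim eq → minimal-split Q prim (subst (λ Δ → ¬ + 2 ∣ Δ) (sym eq) 2∤Δ)
         (subst (_≡ 1ℤ [mod 8 ]) (sym eq) Δ≡1) (subst (λ Δ → IsLeastOddPrimeDivisor Δ pmin) (sym eq) isP)
         (subst (λ Δ → IsLeastOddNonresiduePrime Δ qmin) (sym eq) isQ))
    where
    2∤Δ : ¬ + 2 ∣ Δ
    2∤Δ = odd-disc {Δ} Δ≡1
    2≤D : ∀ n → - + suc n ≡ 1ℤ [mod 4 ] → 2 ℕ.≤ suc n
    -- Δ = -1 is 3 modulo 4, hence excluded; this is what guarantees an odd prime divisor.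
    2≤D zero    h = ⊥-elim (from-no (+ 4 ∣? - + 1 - 1ℤ) h)
    2≤D (suc _) _ = ℕ.s≤s (ℕ.s≤s ℕ.z≤n)

  -- Discriminants divisible by 4

  quarter-disc : ℕ → ℕ → ℤ
  quarter-disc n m = - + (2 ℕ.^ n ℕ.* m)

  4*quarter-disc : ∀ n m → - + (2 ℕ.^ suc (suc n) ℕ.* m) ≡ + 4 * quarter-disc n m
  4*quarter-disc n m = trans (cong (λ k → - + k) (assoc (2 ℕ.^ n) m))
    (trans (cong -_ (ℤ.pos-* 4 (2 ℕ.^ n ℕ.* m))) (ℤ.neg-distribʳ-* (+ 4) (+ (2 ℕ.^ n ℕ.* m))))
    where
    assoc : ∀ t m → 2 ℕ.* (2 ℕ.* t) ℕ.* m ≡ 4 ℕ.* (t ℕ.* m)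
    assoc = ℕ-solve

  -- Passing to Δ / 4 lowers the exponent of 2 by two, so the exceptional n = 3 of the formula
  -- appears here as 1. For m = 2h + 1, -2m - 2 is -4(h + 1).
  quarter-disc≡2 : ∀ m → Odd m → quarter-disc 1 m ≡ + 2 [mod 4 ]
  quarter-disc≡2 m odd = go (half odd)
    where
    go : ∃[ h ] m ≡ suc (h ℕ.+ h) → quarter-disc 1 m ≡ + 2 [mod 4 ]
    go (h , refl) = ∣-*ˡ (∣-neg (ℕ.divides (suc h) (identity h))) 1ℤ (shift (2 ℕ.^ 1 ℕ.* suc (h ℕ.+ h)))
      where
      identity : ∀ h → 2 ℕ.* 1 ℕ.* suc (h ℕ.+ h) ℕ.+ 2 ≡ suc h ℕ.* 4
      identity = ℕ-solve
      cancel : ∀ k → - k - + 2 ≡ 1ℤ * - (k + + 2)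
      cancel = solve-∀
      shift : ∀ k → - + k - + 2 ≡ 1ℤ * - + (k ℕ.+ 2)
      shift k = cancel (+ k)

  -- Exponent 0 gives an odd number, and exponents from 2 on give multiples of 4.
  quarter-disc≢2 : ∀ n m → Odd m → n ≢ 1 → ¬ quarter-disc n m ≡ + 2 [mod 4 ]
  quarter-disc≢2 0 m odd _ h = odd (subst (2 ℕ.∣_) (ℕ.+-identityʳ m) (∣-neg⁻
    (∣-combine (∣-trans (divides (+ 2) refl) h) (∣-refl {+ 2}) 1ℤ 1ℤ (identity (quarter-disc 0 m)))))
    where
    identity : ∀ d → d ≡ 1ℤ * (d - + 2) + 1ℤ * + 2
    identity = solve-∀
  quarter-disc≢2 1 m odd n≢1 _ = n≢1 refl
  quarter-disc≢2 (suc (suc n)) m odd _ h = from-no (4 ℕ.∣? 2) (+∣+⇒∣ (∣-combine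
    (divides (quarter-disc n m) (trans (4*quarter-disc n m) (ℤ.*-comm (+ 4) (quarter-disc n m))))
    h 1ℤ -1ℤ (identity (quarter-disc (suc (suc n)) m))))
    where
    identity : ∀ d → + 2 ≡ 1ℤ * d + -1ℤ * (d - + 2)
    identity = solve-∀

  oddPrime∣2^n*m : ∀ {p} → OddPrime p → ∀ n m → p ℕ.∣ 2 ℕ.^ n ℕ.* m → p ℕ.∣ m
  oddPrime∣2^n*m op zero m p∣m = subst (_ ℕ.∣_) (ℕ.*-identityˡ m) p∣m
  oddPrime∣2^n*m {p} op@(pp , _) (suc n) m p∣
    with euclidsLemma 2 (2 ℕ.^ n ℕ.* m) pp (subst (p ℕ.∣_) (ℕ.*-assoc 2 (2 ℕ.^ n) m) p∣)
  ... | inj₁ p∣2 = contradiction (∣⇒+∣+ p∣2) (oddPrime-∤2 op)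
  ... | inj₂ h   = oddPrime∣2^n*m op n m h

  part-I : ∀ D Δ → Δ ≡ - + suc D → + 4 ∣ Δ → PartI Δ (MinimalModulus Δ)
  part-I D Δ Δ≡-D 4∣Δ = go (split-power 2 ℕ.≤-refl (suc D) (ℕ.s≤s ℕ.z≤n))
    where
    4∣D : 4 ℕ.∣ suc D
    4∣D = ∣-neg⁻ (subst (+ 4 ∣_) Δ≡-D 4∣Δ)
    go : ∃[ n ] ∃[ m ] suc D ≡ 2 ℕ.^ n ℕ.* m × Odd m → PartI Δ (MinimalModulus Δ)
    go (0 , m , eq , odd) = contradiction (subst (2 ℕ.∣_) (trans eq (ℕ.*-identityˡ m)) (ℕ.∣-trans (ℕ.divides 2 refl) 4∣D)) odd
    go (1 , m , eq , odd) = contradiction (ℕ.*-cancelˡ-∣ 2 (subst (4 ℕ.∣_) eq 4∣D)) odd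
    go (suc (suc n) , m , eq , odd) = suc (suc n) , m , (ℕ.s≤s (ℕ.s≤s ℕ.z≤n) , 1≤m , odd , Δ≡) ,
      (λ m≡1 n≡3 → with-8 n≡3 8 (ℕ.s≤s ℕ.z≤n) ℕ.≤-refl (no-odd-prime m≡1) λ Q prim → obstruction-8′ n≡3 Q prim) ,
      (λ m≡1 n≢3 → with-4 4 (ℕ.s≤s ℕ.z≤n) ℕ.≤-refl (no-odd-prime m≡1) λ Q prim → obstruction-4′ n≢3 Q prim) ,
      λ m≢1 →
        let p , op , p∣m = odd-prime-divisor m (ℕ.≤∧≢⇒< 1≤m (≢-sym m≢1)) odd
            pmin , isP@((opmin , pmin∣Δ) , pmin≤) = leastOddPrimeDivisor Δ op
              (subst (+ p ∣_) (sym Δ≡) (∣-neg (ℕ.∣n⇒∣m*n (2 ℕ.^ suc (suc n)) p∣m)))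
            below : ∀ k p → OddPrime p → p ℕ.< k ℕ.⊓ pmin → ¬ + p ∣ Δ
            below k p op p< p∣Δ = ℕ.<⇒≱ (ℕ.<-≤-trans p< (ℕ.m⊓n≤n k pmin)) (pmin≤ p (op , p∣Δ))
            ramified : ∀ Q → Primitive Q → disc Q ≡ Δ → HasLocalObstruction Q pmin
            ramified Q prim e = obstruction-ramified Q prim opmin (subst (+ pmin ∣_) (sym e) pmin∣Δ)
        in pmin , isP ,
           (λ n≡3 → with-8 n≡3 (8 ℕ.⊓ pmin) (⊓-intro (1 ℕ.≤_) 8 pmin (ℕ.s≤s ℕ.z≤n) (oddPrime⇒1≤ opmin)) (ℕ.m⊓n≤m 8 pmin) (below 8)
             λ Q prim e → ⊓-intro (HasLocalObstruction Q) 8 pmin (obstruction-8′ n≡3 Q prim e) (ramified Q prim e)) ,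
           (λ n≢3 → with-4 (4 ℕ.⊓ pmin) (⊓-intro (1 ℕ.≤_) 4 pmin (ℕ.s≤s ℕ.z≤n) (oddPrime⇒1≤ opmin)) (ℕ.m⊓n≤m 4 pmin) (below 4)
             λ Q prim e → ⊓-intro (HasLocalObstruction Q) 4 pmin (obstruction-4′ n≢3 Q prim e) (ramified Q prim e))
      where
      d = quarter-disc n m
      1≤m : 1 ℕ.≤ m
      1≤m = m*n≥1⇒n≥1 (2 ℕ.^ suc (suc n)) m (subst (1 ℕ.≤_) eq (ℕ.s≤s ℕ.z≤n))
      Δ≡ : Δ ≡ - + (2 ℕ.^ suc (suc n) ℕ.* m)
      Δ≡ = trans Δ≡-D (cong (λ k → - + k) eq)
      Δ≡4d : Δ ≡ + 4 * d
      Δ≡4d = trans Δ≡ (4*quarter-disc n m)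
      d≡2 : suc (suc n) ≡ 3 → d ≡ + 2 [mod 4 ]
      d≡2 refl = quarter-disc≡2 m odd
      d≢2 : suc (suc n) ≢ 3 → ¬ d ≡ + 2 [mod 4 ]
      d≢2 n≢3 = quarter-disc≢2 n m odd λ n≡1 → n≢3 (cong (λ k → suc (suc k)) n≡1)
      obstruction-8′ : suc (suc n) ≡ 3 → ∀ Q → Primitive Q → disc Q ≡ Δ → HasLocalObstruction Q 8
      obstruction-8′ n≡3 Q prim e = obstruction-8 Q prim d (trans e Δ≡4d) (d≡2 n≡3)
      obstruction-4′ : suc (suc n) ≢ 3 → ∀ Q → Primitive Q → disc Q ≡ Δ → HasLocalObstruction Q 4
      obstruction-4′ n≢3 Q prim e = obstruction-4 Q prim d (trans e Δ≡4d) (d≢2 n≢3)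
      -- For m = 1 the discriminant is minus a power of 2, so κ is decided at the prime 2 alone.
      no-odd-prime : m ≡ 1 → ∀ {κ} p → OddPrime p → p ℕ.< κ → ¬ + p ∣ Δ
      no-odd-prime m≡1 p op _ p∣Δ = prime⇒∤1 (proj₁ op) (∣⇒+∣+ (subst (p ℕ.∣_) m≡1
        (oddPrime∣2^n*m op (suc (suc n)) m (∣-neg⁻ (subst (+ p ∣_) Δ≡ p∣Δ)))))
      with-8 : suc (suc n) ≡ 3 → ∀ κ → 1 ℕ.≤ κ → κ ℕ.≤ 8 → (∀ p → OddPrime p → p ℕ.< κ → ¬ + p ∣ Δ) →
        (∀ Q → Primitive Q → disc Q ≡ Δ → HasLocalObstruction Q κ) → MinimalModulus Δ κ
      with-8 n≡3 κ 1≤κ κ≤8 unramified obstruction Q prim e =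
        minimal-even-8 Q prim d (trans e Δ≡4d) (d≡2 n≡3) κ 1≤κ κ≤8 (obstruction Q prim e)
          λ p op p<κ → subst (λ Δ → ¬ + p ∣ Δ) (sym e) (unramified p op p<κ)
      with-4 : ∀ κ → 1 ℕ.≤ κ → κ ℕ.≤ 4 → (∀ p → OddPrime p → p ℕ.< κ → ¬ + p ∣ Δ) →
        (∀ Q → Primitive Q → disc Q ≡ Δ → HasLocalObstruction Q κ) → MinimalModulus Δ κ
      with-4 κ 1≤κ κ≤4 unramified obstruction Q prim e =
        minimal-even-4 Q prim κ 1≤κ κ≤4 (obstruction Q prim e)
          λ p op p<κ → subst (λ Δ → ¬ + p ∣ Δ) (sym e) (unramified p op p<κ)

  -- Both cases combined, and dependence on the discriminant alone

  disc-mod-4 : ∀ Q → + 4 ∣ disc Q ⊎ disc Q ≡ 1ℤ [mod 4 ]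
  disc-mod-4 Q@(form a b c) = go (+ 2 ∣? b)
    where
    even : ∀ a B c → B * + 2 * (B * + 2) - + 4 * a * c ≡ (B * B - a * c) * + 4
    even = solve-∀
    odd : ∀ a b c → b * b - + 4 * a * c - 1ℤ ≡ 1ℤ * (b * b - 1ℤ) + - (a * c) * + 4
    odd = solve-∀
    by-even : + 2 ∣ b → + 4 ∣ disc Q
    by-even (divides B refl) = divides (B * B - a * c) (even a B c)
    go : Dec (+ 2 ∣ b) → + 4 ∣ disc Q ⊎ disc Q ≡ 1ℤ [mod 4 ]
    go (yes 2∣b) = inj₁ (by-even 2∣b)
    go (no 2∤b)  = inj₂ (∣-combine (∣-trans (divides (+ 2) refl) (odd⇒square≡1 b 2∤b)) (∣-refl {+ 4})
      1ℤ (- (a * c)) (odd a b c))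

  minimal-modulus : ∀ Q → PositiveDefinite Q → ∃[ κ ] MinimalModulus (disc Q) κ
  minimal-modulus Q pos =
    let n , eq = positiveDefinite⇒disc<0 Q pos
    in [ (λ 4∣Δ → partI-value {M = MinimalModulus (disc Q)} (part-I n (disc Q) eq 4∣Δ)) ,
        (λ Δ≡1 → partII-value {M = MinimalModulus (disc Q)} Δ≡1 (part-II n (disc Q) eq Δ≡1)) ]′ (disc-mod-4 Q)

  minimal-unique : ∀ {Q κ κ′} → IsMinimalObstructionModulus Q [ κ ] → IsMinimalObstructionModulus Q κ′ → κ′ ≡ [ κ ]
  minimal-unique {κ′ = [ κ′ ]} (P , min) (P′ , min′) = cong [_] (ℕ.≤-antisym (min′ _ P) (min _ P′))
  minimal-unique {κ′ = ⊤⁺} ((1≤κ , obs) , _) none = contradiction obs (none _ 1≤κ)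

  -- The given κ might a priori be infinite. A finite modulus valid for the whole discriminant
  -- exists, and uniqueness for Q identifies κ with it.
  disc-determines-minimal-modulus : ∀ Q Q′ → Primitive Q → PositiveDefinite Q → Primitive Q′ → disc Q ≡ disc Q′ →
    ∀ κ → IsMinimalObstructionModulus Q κ → IsMinimalObstructionModulus Q′ κ
  disc-determines-minimal-modulus Q Q′ prim pos prim′ eq κ isMin =
    let κ₀ , all = minimal-modulus Q pos
    in subst (IsMinimalObstructionModulus Q′) (sym (minimal-unique {Q} (all Q prim refl) isMin)) (all Q′ prim′ (sym eq))

  MinimalModulusOf : BinaryQuadraticForm → ℕ → Set
  MinimalModulusOf Q κ = IsMinimalObstructionModulus Q [ κ ]

  kappa-formula : ∀ Q → Primitive Q → PositiveDefinite Q →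
    (+ 4 ∣ disc Q → PartI (disc Q) (MinimalModulusOf Q)) ×
    (disc Q ≡ 1ℤ [mod 4 ] → PartII (disc Q) (MinimalModulusOf Q))
  kappa-formula Q prim pos =
    let n , eq = positiveDefinite⇒disc<0 Q pos
    in (λ 4∣Δ → partI-map {M = MinimalModulus (disc Q)} {MinimalModulusOf Q} specialise (part-I n (disc Q) eq 4∣Δ)) ,
       (λ Δ≡1 → partII-map {M = MinimalModulus (disc Q)} {MinimalModulusOf Q} specialise (part-II n (disc Q) eq Δ≡1))
    where
    specialise : ∀ κ → MinimalModulus (disc Q) κ → MinimalModulusOf Q κ
    specialise κ M = M Q prim refl

open import Data.Integer.Base using (ℤ; +_; -_)
open import Data.Integer.Divisibility.Signed using (_∣_)
open import Data.Nat.Base using (ℕ; _*_; _^_; _≤_; _⊓_)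
open import Data.Product.Base using (_×_; _,_; ∃-syntax)
open import Relation.Binary.PropositionalEquality.Core using (_≡_; _≢_)
open import Relation.Nullary.Construct.Add.Supremum using ([_])
open import Relation.Nullary.Negation.Core using (¬_)

corollary1p3 : (∀ (Q Q′ : BinaryQuadraticForm) →
    Primitive Q → PositiveDefinite Q → Primitive Q′ → PositiveDefinite Q′ →
    disc Q ≡ disc Q′ →
    ∀ (κ : ℕ∞) → IsMinimalObstructionModulus Q κ → IsMinimalObstructionModulus Q′ κ)
    ×
    (∀ (Q : BinaryQuadraticForm) → Primitive Q → PositiveDefinite Q →
    (+ 4 ∣ disc Q →
    ∃[ n ] ∃[ m ]
    (2 ≤ n × 1 ≤ m × Odd m × disc Q ≡ - (+ (2 ^ n * m)))
    × (m ≡ 1 → n ≡ 3 → IsMinimalObstructionModulus Q [ 8 ])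
    × (m ≡ 1 → n ≢ 3 → IsMinimalObstructionModulus Q [ 4 ])
    × (m ≢ 1 →
    ∃[ pmin ]
    IsLeastOddPrimeDivisor (disc Q) pmin
    × (n ≡ 3 → IsMinimalObstructionModulus Q [ 8 ⊓ pmin ])
    × (n ≢ 3 → IsMinimalObstructionModulus Q [ 4 ⊓ pmin ])))
    ×
    (disc Q ≡ + 1 [mod 4 ] →
    ∃[ pmin ] ∃[ qmin ]
    IsLeastOddPrimeDivisor (disc Q) pmin
    × IsLeastOddNonresiduePrime (disc Q) qmin
    × (+ 3 ∣ disc Q → IsMinimalObstructionModulus Q [ 3 ])
    × (¬ (+ 3 ∣ disc Q) → disc Q ≡ + 5 [mod 8 ] → IsMinimalObstructionModulus Q [ 4 ])
    × (¬ (+ 3 ∣ disc Q) → disc Q ≡ + 1 [mod 8 ] →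
    IsMinimalObstructionModulus Q [ pmin ⊓ qmin ^ 2 ])))
corollary1p3 =
  (λ Q Q′ prim pos prim′ _ → disc-determines-minimal-modulus Q Q′ prim pos prim′) , kappa-formula
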